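{- Fix an integer $k\ge2$. For each $3$-element subset $A=\{a,b,c\}$ of $\{0,1,\dots,k\}$ with $a<b<c$, let $\rho_A$ be the polymatroid on a $2$-element set $\{e,f\}$ given by $\rho_A(\emptyset)=0$, $\rho_A(\{e\})=b$, $\rho_A(\{f\})=c$, $\rho_A(\{e,f\})=a+c$. Then a $k$-polymatroid is an excluded minor for $\mathcal{Q}_k$ within the class of $k$-polymatroids (i.e., it is not in $\mathcal{Q}_k$ but all of its proper minors are) if and only if it is isomorphic to $\rho_A$ for some such $A$; thus $\mathcal{Q}_k$ has exactly $\binom{k+1}{3}$ excluded minors within the class of $k$-polymatroids.
   Context: A polymatroid on a finite set $E$ is a function $\rho:2^E\to\mathbb{Z}$ that is normalized, non-decreasing and submodular; it is a $k$-polymatroid if $\rho(\{e\})\le k$ for all $e$. For matroids $Q,L$ on $E$, $Q$ is a quotient of $L$ if there is a matroid $M$ and $A\subseteq E(M)$ with $L=M\backslash A$ and $Q=M/A$ (equivalently, $r_L-r_Q$ is non-decreasing). $\mathcal{Q}_k$ is the class of polymatroids of the form $r_{M_1}+\cdots+r_{M_k}$ where each $M_{i+1}$ ($i\in[k-1]$) is a quotient of (possibly equal to) $M_i$. Minors: $\rho_{\backslash A}(X)=\rho(X)$, $\rho_{/A}(X)=\rho(X\cup A)-\rho(A)$ for $X\subseteq E-A$; minors are $(\rho_{\backslash A})_{/B}$ for disjoint $A,B$, proper if $A\cup B\ne\emptyset$. Polymatroids are isomorphic if a bijection of ground sets preserves the rank function. -}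

module Defs where

open import Data.Nat as ℕ using (ℕ; suc; z≤n; s≤s)
import Data.Nat.Properties as ℕ
open import Data.Integer using (ℤ; +_; _+_; _-_; _≤_; 0ℤ; +≤+)
import Data.Integer.Properties as ℤ
open import Data.Integer.Tactic.RingSolver using (solve-∀)
open import Data.Fin using (Fin; toℕ)
open import Data.Fin.Subset
  using (Subset; inside; outside; _∈_; _⊆_; _∪_; _∩_; _─_; ⊥; ⊤; ⁅_⁆; ∣_∣; Nonempty)
open import Data.Fin.Subset.Properties
open import Data.Vec using ([]; _∷_; _++_; here; there)
open import Data.Product using (∃-syntax; Σ-syntax; _×_; _,_; proj₁)
open import Data.Sum using (inj₁; inj₂)
open import Function using (_∘_)
open import Function.Bundles using (_↔_; _⇔_; Inverse)
open import Relation.Nullary using (¬_; contradiction)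
open import Relation.Binary.PropositionalEquality
open import Algebra.Properties.Monoid.Sum ℤ.+-0-monoid using (sum)

private
  variable
    m n k : ℕ
    A B E F X Y Z : Subset n

-- The ground set E is an arbitrary subset of Fin n, so that minors on subsets
-- of E need no relabelling.  Values of `rank` off the subsets of E are junk and
-- are never referred to.
record Polymatroid {n : ℕ} (E : Subset n) : Set where
  field
    rank       : Subset n → ℤ
    normalized : rank ⊥ ≡ 0ℤ
    monotone   : ∀ {X Y} → X ⊆ Y → Y ⊆ E → rank X ≤ rank Y
    submodular : ∀ {X Y} → X ⊆ E → Y ⊆ E →
                 rank (X ∪ Y) + rank (X ∩ Y) ≤ rank X + rank Y

open Polymatroid public

IsKPolymatroid : ℕ → {E : Subset n} → Polymatroid E → Set
IsKPolymatroid k {E} ρ = ∀ e → e ∈ E → rank ρ ⁅ e ⁆ ≤ + k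

-- Matroids are given by their rank functions; 0 ≤ rank X follows from
-- normalization and monotonicity.
record Matroid {n : ℕ} (E : Subset n) : Set where
  field
    polymatroid : Polymatroid E
    rank≤size   : ∀ {X} → X ⊆ E → rank polymatroid X ≤ + ∣ X ∣

  r : Subset n → ℤ
  r = rank polymatroid

open Matroid public

private
  ∪-⊆ : (X Y : Subset n) → X ⊆ Z → Y ⊆ Z → X ∪ Y ⊆ Z
  ∪-⊆ X Y X⊆Z Y⊆Z x∈ with x∈p∪q⁻ X Y x∈
  ... | inj₁ x∈X = X⊆Z x∈X
  ... | inj₂ x∈Y = Y⊆Z x∈Y

  ∪-monoˡ : (X Y A : Subset n) → X ⊆ Y → X ∪ A ⊆ Y ∪ A
  ∪-monoˡ X Y A X⊆Y = ∪-⊆ X A (p⊆p∪q A ∘ X⊆Y) (q⊆p∪q Y A)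

  ∪-∪-distribʳ : (X Y A : Subset n) → (X ∪ Y) ∪ A ≡ (X ∪ A) ∪ (Y ∪ A)
  ∪-∪-distribʳ X Y A = ⊆-antisym
    (∪-⊆ (X ∪ Y) A
      (∪-⊆ X Y (p⊆p∪q (Y ∪ A) ∘ p⊆p∪q A) (q⊆p∪q (X ∪ A) (Y ∪ A) ∘ p⊆p∪q A))
      (p⊆p∪q (Y ∪ A) ∘ q⊆p∪q X A))
    (∪-⊆ (X ∪ A) (Y ∪ A)
      (∪-monoˡ X (X ∪ Y) A (p⊆p∪q Y))
      (∪-monoˡ Y (X ∪ Y) A (q⊆p∪q X Y)))

  ─-∪-⊆ : (X A : Subset n) → A ⊆ E → X ⊆ E ─ A → X ∪ A ⊆ E
  ─-∪-⊆ {E = E} X A A⊆E X⊆ = ∪-⊆ X A (p─q⊆p E A ∘ X⊆) A⊆E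

  shift : ∀ x y a → (x - a) + (y - a) ≡ (x + y) + ((0ℤ - a) - a)
  shift = solve-∀

  ⊥++⊤⊆ : (E : Subset n) → ⊥ {n} ++ ⊤ {m} ⊆ E ++ ⊤
  ⊥++⊤⊆ []      x∈         = x∈
  ⊥++⊤⊆ (_ ∷ E) (there x∈) = there (⊥++⊤⊆ E x∈)

delete : Polymatroid E → (A : Subset n) → Polymatroid (E ─ A)
delete {E = E} ρ A = record
  { rank       = rank ρ
  ; normalized = normalized ρ
  ; monotone   = λ X⊆Y Y⊆ → monotone ρ X⊆Y (p─q⊆p E A ∘ Y⊆)
  ; submodular = λ X⊆ Y⊆ → submodular ρ (p─q⊆p E A ∘ X⊆) (p─q⊆p E A ∘ Y⊆)
  }

contract : Polymatroid E → (A : Subset n) → A ⊆ E → Polymatroid (E ─ A)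
contract ρ A A⊆E = record
  { rank       = λ X → rank ρ (X ∪ A) - rank ρ A
  ; normalized = trans (cong (λ Z → rank ρ Z - rank ρ A) (∪-identityˡ A))
                       (ℤ.+-inverseʳ (rank ρ A))
  ; monotone   = λ {X} {Y} X⊆Y Y⊆ →
      ℤ.+-monoˡ-≤ _ (monotone ρ (∪-monoˡ X Y A X⊆Y) (─-∪-⊆ Y A A⊆E Y⊆))
  ; submodular = λ {X} {Y} X⊆ Y⊆ →
      subst₂ _≤_
        (sym (trans
          (cong₂ (λ U V → (rank ρ U - rank ρ A) + (rank ρ V - rank ρ A))
            (∪-∪-distribʳ X Y A) (∪-distribʳ-∩ A X Y))
          (shift (rank ρ ((X ∪ A) ∪ (Y ∪ A))) (rank ρ ((X ∪ A) ∩ (Y ∪ A))) (rank ρ A))))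
        (sym (shift (rank ρ (X ∪ A)) (rank ρ (Y ∪ A)) (rank ρ A)))
        (ℤ.+-monoˡ-≤ _ (submodular ρ (─-∪-⊆ X A A⊆E X⊆) (─-∪-⊆ Y A A⊆E Y⊆)))
  }

-- The matroid M of the definition lives on the disjoint union of E and a set A
-- of m further elements; X ⊆ E is the subset X ++ ⊥ of E(M), and A is ⊥ ++ ⊤.
IsQuotientOf : Matroid E → Matroid E → Set
IsQuotientOf {n} {E} Q L =
  Σ[ m ∈ ℕ ] Σ[ M ∈ Matroid (E ++ ⊤ {m}) ]
    let A = ⊥ {n} ++ ⊤ {m} in
    ∀ {X} → X ⊆ E →
      (r L X ≡ rank (delete (polymatroid M) A) (X ++ ⊥)) ×
      (r Q X ≡ rank (contract (polymatroid M) A (⊥++⊤⊆ E)) (X ++ ⊥))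

𝒬 : ℕ → {E : Subset n} → Polymatroid E → Set
𝒬 k {E} ρ =
  Σ[ M ∈ (Fin k → Matroid E) ]
    (∀ i j → toℕ j ≡ suc (toℕ i) → IsQuotientOf (M j) (M i)) ×
    (∀ {X} → X ⊆ E → rank ρ X ≡ sum (λ i → r (M i) X))

IsExcludedMinor : ℕ → {E : Subset n} → Polymatroid E → Set
IsExcludedMinor k {E} ρ =
  (¬ 𝒬 k ρ) ×
  (∀ A B → A ⊆ E → (B⊆ : B ⊆ E ─ A) → Nonempty (A ∪ B) →
    𝒬 k (contract (delete ρ A) B B⊆))

Elements : Subset n → Set
Elements E = ∃[ e ] e ∈ E

-- The inner hypothesis says that Y is the image of X under φ.
_≅_ : {E : Subset m} {F : Subset n} → Polymatroid E → Polymatroid F → Set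
_≅_ {E = E} {F = F} ρ σ =
  Σ[ φ ∈ Elements E ↔ Elements F ]
    (∀ {X Y} → X ⊆ E → Y ⊆ F →
      (∀ e → proj₁ e ∈ X ⇔ proj₁ (Inverse.to φ e) ∈ Y) →
      rank ρ X ≡ rank σ Y)

infix 4 _≅_

record ThreeSubset (k : ℕ) : Set where
  field
    a b c : ℕ
    a<b   : a ℕ.< b
    b<c   : b ℕ.< c
    c≤k   : c ℕ.≤ k

-- Here e is element 0 and f is element 1 of Fin 2.
ρ[_] : ThreeSubset k → Polymatroid (⊤ {2})
ρ[ A ] = record
  { rank       = rk
  ; normalized = refl
  ; monotone   = λ {X} {Y} X⊆Y _ → mono X Y X⊆Y
  ; submodular = λ {X} {Y} _ _ → submod X Y
  }
  where
  open ThreeSubset A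

  rk : Subset 2 → ℤ
  rk (outside ∷ outside ∷ []) = 0ℤ
  rk (inside  ∷ outside ∷ []) = + b
  rk (outside ∷ inside  ∷ []) = + c
  rk (inside  ∷ inside  ∷ []) = + (a ℕ.+ c)

  mono : ∀ X Y → X ⊆ Y → rk X ≤ rk Y
  mono (outside ∷ outside ∷ []) (outside ∷ outside ∷ []) _ = ℤ.≤-refl
  mono (outside ∷ outside ∷ []) (inside  ∷ outside ∷ []) _ = +≤+ z≤n
  mono (outside ∷ outside ∷ []) (outside ∷ inside  ∷ []) _ = +≤+ z≤n
  mono (outside ∷ outside ∷ []) (inside  ∷ inside  ∷ []) _ = +≤+ z≤n
  mono (inside  ∷ outside ∷ []) (inside  ∷ outside ∷ []) _ = ℤ.≤-refl
  mono (inside  ∷ outside ∷ []) (inside  ∷ inside  ∷ []) _ =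
    +≤+ (ℕ.≤-trans (ℕ.<⇒≤ b<c) (ℕ.m≤n+m c a))
  mono (outside ∷ inside  ∷ []) (outside ∷ inside  ∷ []) _ = ℤ.≤-refl
  mono (outside ∷ inside  ∷ []) (inside  ∷ inside  ∷ []) _ = +≤+ (ℕ.m≤n+m c a)
  mono (inside  ∷ inside  ∷ []) (inside  ∷ inside  ∷ []) _ = ℤ.≤-refl
  mono (inside  ∷ _       ∷ []) (outside ∷ _       ∷ []) s = contradiction (s here) λ ()
  mono (_       ∷ inside  ∷ []) (_       ∷ outside ∷ []) s with s (there here)
  ... | there ()

  ab : + (a ℕ.+ c) + 0ℤ ≤ + b + + c
  ab = subst (_≤ + b + + c) (sym (ℤ.+-identityʳ _))
         (+≤+ (ℕ.+-monoˡ-≤ c (ℕ.<⇒≤ a<b)))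

  eq : ∀ x y → x + y ≤ x + y
  eq _ _ = ℤ.≤-refl

  qe : ∀ x y → x + y ≤ y + x
  qe x y = ℤ.≤-reflexive (ℤ.+-comm x y)

  submod : ∀ X Y → rk (X ∪ Y) + rk (X ∩ Y) ≤ rk X + rk Y
  submod (outside ∷ outside ∷ []) (outside ∷ outside ∷ []) = eq 0ℤ 0ℤ
  submod (outside ∷ outside ∷ []) (outside ∷ inside  ∷ []) = qe (+ c) 0ℤ
  submod (outside ∷ outside ∷ []) (inside  ∷ outside ∷ []) = qe (+ b) 0ℤ
  submod (outside ∷ outside ∷ []) (inside  ∷ inside  ∷ []) = qe (+ (a ℕ.+ c)) 0ℤ
  submod (outside ∷ inside  ∷ []) (outside ∷ outside ∷ []) = eq (+ c) 0ℤ
  submod (outside ∷ inside  ∷ []) (outside ∷ inside  ∷ []) = eq (+ c) (+ c)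
  submod (outside ∷ inside  ∷ []) (inside  ∷ outside ∷ []) =
    subst (+ (a ℕ.+ c) + 0ℤ ≤_) (ℤ.+-comm (+ b) (+ c)) ab
  submod (outside ∷ inside  ∷ []) (inside  ∷ inside  ∷ []) = qe (+ (a ℕ.+ c)) (+ c)
  submod (inside  ∷ outside ∷ []) (outside ∷ outside ∷ []) = eq (+ b) 0ℤ
  submod (inside  ∷ outside ∷ []) (outside ∷ inside  ∷ []) = ab
  submod (inside  ∷ outside ∷ []) (inside  ∷ outside ∷ []) = eq (+ b) (+ b)
  submod (inside  ∷ outside ∷ []) (inside  ∷ inside  ∷ []) = qe (+ (a ℕ.+ c)) (+ b)
  submod (inside  ∷ inside  ∷ []) (outside ∷ outside ∷ []) = eq (+ (a ℕ.+ c)) 0ℤ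
  submod (inside  ∷ inside  ∷ []) (outside ∷ inside  ∷ []) = eq (+ (a ℕ.+ c)) (+ c)
  submod (inside  ∷ inside  ∷ []) (inside  ∷ outside ∷ []) = eq (+ (a ℕ.+ c)) (+ b)
  submod (inside  ∷ inside  ∷ []) (inside  ∷ inside  ∷ []) = eq (+ (a ℕ.+ c)) (+ (a ℕ.+ c))

record ExcludedMinor (k : ℕ) : Set where
  field
    {size}          : ℕ
    {ground}        : Subset size
    ρ               : Polymatroid ground
    isKPolymatroid  : IsKPolymatroid k ρ
    isExcludedMinor : IsExcludedMinor k ρ

-- There are exactly N excluded minors, counted up to isomorphism.
ExactlyExcludedMinors : ℕ → ℕ → Set
ExactlyExcludedMinors k N =
  Σ[ τ ∈ (Fin N → ExcludedMinor k) ]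
    (∀ i j → ρ (τ i) ≅ ρ (τ j) → i ≡ j) ×
    (∀ (σ : ExcludedMinor k) → ∃[ i ] ρ σ ≅ ρ (τ i))
  where open ExcludedMinor

-- For ρ = r(M₁) + ⋯ + r(Mₖ) with each M(i+1) a quotient of M(i), the marginals
-- r(Mᵢ)(X ∪ e) - r(Mᵢ)(X) are 0 or 1 and decrease in i, so that r(Mᵢ) increases
-- from X to X ∪ e exactly when i ≤ ρ(X ∪ e) - ρ(X).  Conversely this rule defines
-- such matroids as soon as it is independent of the order in which elements are
-- added, that is, if for all X, e, g the multisets of marginals
--   {ρ(X ∪ e) - ρ(X), ρ(X ∪ e ∪ g) - ρ(X ∪ e)} and
--   {ρ(X ∪ g) - ρ(X), ρ(X ∪ e ∪ g) - ρ(X ∪ g)}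
-- coincide.  Equivalently, ρ(X ∪ e) = ρ(X ∪ g) or
-- ρ(X ∪ e) + ρ(X ∪ g) = ρ(X) + ρ(X ∪ e ∪ g) (`Balanced`).  A violation at
-- (X, e, g) survives contracting X and deleting all other elements, so an excluded
-- minor has ground set {e, g} and violates the condition at X = ∅, which says that
-- it is some ρ_A.
module Submission where

open import Data.Nat using (ℕ; suc; _≤_)
open import Data.Nat.Combinatorics using (_C_; nCk+nC[k+1]≡[n+1]C[k+1])
open import Data.Fin.Subset using (Subset)
open import Data.Product using (_×_; Σ-syntax)
open import Function.Bundles using (_⇔_)
open import Defs

open import Data.Bool using (if_then_else_; _∨_; _∧_)
open import Data.Nat as ℕ using (zero; z≤n; s≤s)
import Data.Nat.Properties as ℕ
open import Data.Integer as ℤ using (ℤ; +_; -[1+_]; 0ℤ; 1ℤ; _+_; _-_; _⊓_; +≤+)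
import Data.Integer.Properties as ℤ
open import Data.Integer.Tactic.RingSolver using (solve-∀)
open import Data.Fin using (Fin; zero; suc; toℕ)
import Data.Fin.Properties as Fin
open import Data.Fin.Properties using (any?; +↔⊎)
open import Data.Fin.Subset
  using (Side; inside; outside; _∈_; _∉_; _⊆_; _∪_; _∩_; _─_; ⊥; ⊤; ⁅_⁆; ∣_∣; Nonempty)
open import Data.Fin.Subset.Properties
open import Data.Vec using (Vec; []; _∷_; _++_; here; there; take; drop; lookup)
open import Data.Vec.Properties
  using ([]=⇒lookup; lookup⇒[]=; take-zipWith; drop-zipWith; take++drop≡id; zipWith-++;
         ++-injectiveˡ; ++-injectiveʳ)
open import Data.Vec.Properties.WithK using ([]=-irrelevant)
open import Data.Product using (_,_; proj₁; proj₂; ∃-syntax)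
open import Data.Sum using (_⊎_; inj₁; inj₂; swap)
open import Data.Sum.Function.Propositional using (_⊎-↔_)
open import Function using (_∘_; id)
open import Function.Bundles using (_↔_; mk↔ₛ′; mk⇔; Inverse; Equivalence)
open import Function.Properties.Inverse using (↔-trans)
open import Relation.Nullary using (¬_; Dec; yes; no; contradiction; ¬?; _×-dec_; _⊎-dec_)
open import Relation.Nullary.Decidable using (decidable-stable)
open import Relation.Binary using (tri<; tri≈; tri>)
open import Relation.Binary.PropositionalEquality
open import Algebra.Properties.AbelianGroup ℤ.+-0-abelianGroup using (∙-cancelʳ)
open import Algebra.Properties.CommutativeMonoid.Sum ℤ.+-0-commutativeMonoid
  using (sum; sum-cong-≗; ∑-distrib-+)

-- Integer inequalities and subsets

-- Linear inequalities are obtained from a known inequality with the same slack, so that only a ring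
-- identity is left for the solver.
≤-by-difference : ∀ {x y u v} → x ℤ.≤ y → y - x ≡ v - u → u ℤ.≤ v
≤-by-difference x≤y eq = ℤ.0≤i-j⇒j≤i (subst (0ℤ ℤ.≤_) eq (ℤ.i≤j⇒0≤j-i x≤y))

⊆⇒∪≡ : ∀ {n} {p q : Subset n} → p ⊆ q → p ∪ q ≡ q
⊆⇒∪≡ {p = p} {q} p⊆q = ⊆-antisym split (q⊆p∪q p q)
  where
  split : p ∪ q ⊆ q
  split x∈ with x∈p∪q⁻ p q x∈
  ... | inj₁ x∈p = p⊆q x∈p
  ... | inj₂ x∈q = x∈q

∪≡⇒⊆ : ∀ {n} {p q : Subset n} → p ∪ q ≡ q → p ⊆ q
∪≡⇒⊆ {p = p} {q} eq x∈p = subst (_ ∈_) eq (p⊆p∪q {p = p} q x∈p)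

∪-least : ∀ {n} {p q s : Subset n} → p ⊆ s → q ⊆ s → p ∪ q ⊆ s
∪-least {p = p} {q} p⊆s q⊆s x∈ with x∈p∪q⁻ p q x∈
... | inj₁ x∈p = p⊆s x∈p
... | inj₂ x∈q = q⊆s x∈q

∪-monoˡ-⊆ : ∀ {n} {p q : Subset n} s → p ⊆ q → p ∪ s ⊆ q ∪ s
∪-monoˡ-⊆ {q = q} s p⊆q = ∪-least (p⊆p∪q s ∘ p⊆q) (q⊆p∪q q s)

⁅⁆⊆ : ∀ {n} {e : Fin n} {p} → e ∈ p → ⁅ e ⁆ ⊆ p
⁅⁆⊆ {e = e} e∈p x∈ = subst (_∈ _) (sym (x∈⁅y⁆⇒x≡y e x∈)) e∈p

∪⁅⁆-absorb : ∀ {n} {e : Fin n} {p} → e ∈ p → p ∪ ⁅ e ⁆ ≡ p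
∪⁅⁆-absorb {e = e} {p} e∈p = trans (∪-comm p ⁅ e ⁆) (⊆⇒∪≡ (⁅⁆⊆ e∈p))

∪-swap : ∀ {n} (p q s : Subset n) → (p ∪ q) ∪ s ≡ (p ∪ s) ∪ q
∪-swap p q s =
  trans (∪-assoc p q s) (trans (cong (p ∪_) (∪-comm q s)) (sym (∪-assoc p s q)))

⊆⇒∩≡ : ∀ {n} {p q : Subset n} → p ⊆ q → p ∩ q ≡ p
⊆⇒∩≡ {p = p} {q} p⊆q = ⊆-antisym (p∩q⊆p p q) (λ x∈p → x∈p∩q⁺ (x∈p , p⊆q x∈p))

-- Set functions and one-element steps

subset-induction : ∀ {n} (P : Subset n → Set) → P ⊥ →
                   (∀ X e → P X → P (X ∪ ⁅ e ⁆)) → ∀ X → P X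
subset-induction P P⊥ step []            = P⊥
subset-induction {suc n} P P⊥ step (s ∷ X) = by-head s
  where
  without-zero : P (outside ∷ X)
  without-zero =
    subset-induction (P ∘ (outside ∷_)) P⊥ (λ Y e → step (outside ∷ Y) (suc e)) X

  by-head : ∀ s → P (s ∷ X)
  by-head outside = without-zero
  by-head inside  =
    subst (P ∘ (inside ∷_)) (∪-identityʳ X) (step (outside ∷ X) zero without-zero)

increasing : ∀ {n} (f : Subset n → ℤ) → (∀ X e → f X ℤ.≤ f (X ∪ ⁅ e ⁆)) →
             ∀ {X Y} → X ⊆ Y → f X ℤ.≤ f Y
increasing f step {X} {Y} X⊆Y = subst (λ S → f X ℤ.≤ f S) (⊆⇒∪≡ X⊆Y)
  (subset-induction (λ Z → f X ℤ.≤ f (X ∪ Z))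
    (ℤ.≤-reflexive (cong f (sym (∪-identityʳ X))))
    (λ Z e ih → ℤ.≤-trans ih
      (subst (λ S → f (X ∪ Z) ℤ.≤ f S) (∪-assoc X Z ⁅ e ⁆) (step (X ∪ Z) e)))
    Y)

-- The hypothesis makes the loss `f U - f (U ∪ ⁅ e ⁆)` non-decreasing along one-element extensions
-- of `U`, hence along inclusions. Losses over a whole set `Z` telescope into such losses; comparing
-- `X ∩ Y ⊆ X` with `Z = Y` then gives submodularity.
submodular-from-elements :
  ∀ {n} (f : Subset n → ℤ) →
  (∀ X e g → f X - f (X ∪ ⁅ e ⁆) ℤ.≤ f (X ∪ ⁅ g ⁆) - f ((X ∪ ⁅ g ⁆) ∪ ⁅ e ⁆)) →
  ∀ X Y → f (X ∪ Y) + f (X ∩ Y) ℤ.≤ f X + f Y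
submodular-from-elements {n} f step X Y =
  ≤-by-difference
    (subst (λ S → f (X ∩ Y) - f S ℤ.≤ f X - f (X ∪ Y)) (⊆⇒∪≡ (p∩q⊆q X Y))
      (by-sets (p∩q⊆p X Y) Y))
    (rearrange (f X) (f Y) (f (X ∪ Y)) (f (X ∩ Y)))
  where
  rearrange : ∀ x y u i → (x - u) - (i - y) ≡ (x + y) - (u + i)
  rearrange = solve-∀

  by-sets : ∀ {S T : Subset n} → S ⊆ T → ∀ Z → f S - f (S ∪ Z) ℤ.≤ f T - f (T ∪ Z)
  by-sets {S} {T} S⊆T = subset-induction _ base extend
    where
    loss-⊥ : ∀ U → f U - f (U ∪ ⊥) ≡ 0ℤ
    loss-⊥ U = trans (cong (λ V → f U - f V) (∪-identityʳ U)) (ℤ.+-inverseʳ (f U))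

    base : f S - f (S ∪ ⊥) ℤ.≤ f T - f (T ∪ ⊥)
    base = ℤ.≤-reflexive (trans (loss-⊥ S) (sym (loss-⊥ T)))

    telescope : ∀ U Z e → (f U - f (U ∪ Z)) + (f (U ∪ Z) - f ((U ∪ Z) ∪ ⁅ e ⁆))
                        ≡ f U - f (U ∪ (Z ∪ ⁅ e ⁆))
    telescope U Z e =
      trans (ℤ.+-minus-telescope (f U) (f (U ∪ Z)) (f ((U ∪ Z) ∪ ⁅ e ⁆)))
            (cong (λ V → f U - f V) (∪-assoc U Z ⁅ e ⁆))

    extend : ∀ Z e → f S - f (S ∪ Z) ℤ.≤ f T - f (T ∪ Z) →
             f S - f (S ∪ (Z ∪ ⁅ e ⁆)) ℤ.≤ f T - f (T ∪ (Z ∪ ⁅ e ⁆))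
    extend Z e ih = subst₂ ℤ._≤_ (telescope S Z e) (telescope T Z e)
      (ℤ.+-mono-≤ ih
        (increasing (λ U → f U - f (U ∪ ⁅ e ⁆)) (λ U g → step U e g) (∪-monoˡ-⊆ Z S⊆T)))

-- Submodularity at `T` and `S ∪ Z`: their union is `T ∪ Z`, and their intersection contains `S`.
diminishing : ∀ {n} {E S T Z : Subset n} (ρ : Polymatroid E) → S ⊆ T → T ⊆ E → Z ⊆ E →
              rank ρ (T ∪ Z) + rank ρ S ℤ.≤ rank ρ T + rank ρ (S ∪ Z)
diminishing {E = E} {S} {T} {Z} ρ S⊆T T⊆E Z⊆E =
  ℤ.≤-trans
    (ℤ.+-mono-≤
      (ℤ.≤-reflexive (cong (rank ρ) union))
      (monotone ρ (λ x∈S → x∈p∩q⁺ (S⊆T x∈S , p⊆p∪q Z x∈S)) (T⊆E ∘ p∩q⊆p T (S ∪ Z))))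
    (submodular ρ T⊆E (∪-least (T⊆E ∘ S⊆T) Z⊆E))
  where
  union : T ∪ Z ≡ T ∪ (S ∪ Z)
  union = trans (cong (_∪ Z) (sym (trans (∪-comm T S) (⊆⇒∪≡ S⊆T)))) (∪-assoc T S Z)

-- Set functions with prescribed increments.

-- The condition  μ e X + μ f (X ∪ e) = μ f X + μ e (X ∪ f)  makes the total
-- increment along any ordering of X independent of the ordering; `potential`
-- adds the elements in decreasing order.
potential : ∀ {n} → (Fin n → Subset n → ℤ) → Subset n → ℤ
potential μ []      = 0ℤ
potential μ (s ∷ X) =
  potential (λ e Y → μ (suc e) (outside ∷ Y)) X + (if s then μ zero (outside ∷ X) else 0ℤ)

potential-⊥ : ∀ {n} (μ : Fin n → Subset n → ℤ) → potential μ ⊥ ≡ 0ℤ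
potential-⊥ {zero}  μ = refl
potential-⊥ {suc n} μ = trans (ℤ.+-identityʳ _) (potential-⊥ {n} (λ e Y → μ (suc e) (outside ∷ Y)))

-- If the set lacks `zero`, this is the definition or the inductive hypothesis. If `zero` is
-- present, it was added last: adding it again costs nothing by `loop`, and the cocycle condition
-- lets `suc e` be added after it instead of before.
potential-∪ : ∀ {n} (μ : Fin n → Subset n → ℤ) →
  (∀ X e g → μ e X + μ g (X ∪ ⁅ e ⁆) ≡ μ g X + μ e (X ∪ ⁅ g ⁆)) →
  (∀ {X e} → e ∈ X → μ e X ≡ 0ℤ) →
  ∀ X e → potential μ (X ∪ ⁅ e ⁆) ≡ potential μ X + μ e X
potential-∪ μ cocycle loop (outside ∷ X) zero =
  trans (cong (potential μ ∘ (inside ∷_)) (∪-identityʳ X))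
        (cong (_+ μ zero (outside ∷ X))
         (sym (ℤ.+-identityʳ (potential (λ e Y → μ (suc e) (outside ∷ Y)) X))))
potential-∪ μ cocycle loop (inside ∷ X) zero =
  trans (cong (potential μ ∘ (inside ∷_)) (∪-identityʳ X))
        (trans (sym (ℤ.+-identityʳ _))
          (cong (λ z → potential μ (inside ∷ X) + z) (sym (loop here))))
potential-∪ {suc n} μ cocycle loop (s ∷ X) (suc e) = by-head s
  where
  μ′ : Fin n → Subset n → ℤ
  μ′ e Y = μ (suc e) (outside ∷ Y)

  ih : potential μ′ (X ∪ ⁅ e ⁆) ≡ potential μ′ X + μ′ e X
  ih = potential-∪ μ′ (λ Y e g → cocycle (outside ∷ Y) (suc e) (suc g))
                      (λ e∈Y → loop (there e∈Y)) X e

  move-zero : ∀ x y → (x + y) + 0ℤ ≡ (x + 0ℤ) + y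
  move-zero = solve-∀

  rotate : ∀ x y z → (x + y) + z ≡ x + (z + y)
  rotate = solve-∀

  exchange : μ zero (outside ∷ (X ∪ ⁅ e ⁆)) + μ′ e X
           ≡ μ zero (outside ∷ X) + μ (suc e) (inside ∷ X)
  exchange = trans (ℤ.+-comm _ (μ′ e X))
    (trans (sym (cocycle (outside ∷ X) zero (suc e)))
           (cong (λ Y → μ zero (outside ∷ X) + μ (suc e) (inside ∷ Y)) (∪-identityʳ X)))

  by-head : ∀ s → potential μ ((s ∷ X) ∪ ⁅ suc e ⁆) ≡ potential μ (s ∷ X) + μ (suc e) (s ∷ X)
  by-head outside = trans (cong (_+ 0ℤ) ih) (move-zero (potential μ′ X) (μ′ e X))
  by-head inside  =
    trans (cong (_+ μ zero (outside ∷ (X ∪ ⁅ e ⁆))) ih)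
      (trans (rotate (potential μ′ X) (μ′ e X) _)
        (trans (cong (λ z → potential μ′ X + z) exchange)
               (sym (ℤ.+-assoc (potential μ′ X) _ _))))

potential≤size : ∀ {n} (μ : Fin n → Subset n → ℤ) → (∀ e X → μ e X ℤ.≤ 1ℤ) →
                 ∀ X → potential μ X ℤ.≤ + ∣ X ∣
potential≤size μ μ≤1 []            = ℤ.≤-refl
potential≤size μ μ≤1 (outside ∷ X) =
  subst (ℤ._≤ + ∣ X ∣) (sym (ℤ.+-identityʳ _)) (potential≤size _ (λ e Y → μ≤1 _ _) X)
potential≤size μ μ≤1 (inside ∷ X)  =
  subst (potential μ (inside ∷ X) ℤ.≤_) (cong +_ (ℕ.+-comm ∣ X ∣ 1))
    (ℤ.+-mono-≤ (potential≤size _ (λ e Y → μ≤1 _ _) X) (μ≤1 zero (outside ∷ X)))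

-- Threshold indicators.

-- The indicator of i < t.
exceeds : ℕ → ℤ → ℤ
exceeds i       -[1+ _ ]    = 0ℤ
exceeds i       (+ zero)    = 0ℤ
exceeds zero    (+ (suc t)) = 1ℤ
exceeds (suc i) (+ (suc t)) = exceeds i (+ t)

exceeds-0 : ∀ i → exceeds i 0ℤ ≡ 0ℤ
exceeds-0 zero    = refl
exceeds-0 (suc i) = refl

0≤exceeds : ∀ i t → 0ℤ ℤ.≤ exceeds i t
0≤exceeds zero    -[1+ _ ]    = ℤ.≤-refl
0≤exceeds (suc i) -[1+ _ ]    = ℤ.≤-refl
0≤exceeds zero    (+ zero)    = ℤ.≤-refl
0≤exceeds (suc i) (+ zero)    = ℤ.≤-refl
0≤exceeds zero    (+ (suc t)) = +≤+ z≤n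
0≤exceeds (suc i) (+ (suc t)) = 0≤exceeds i (+ t)

exceeds≤1 : ∀ i t → exceeds i t ℤ.≤ 1ℤ
exceeds≤1 zero    -[1+ _ ]    = +≤+ z≤n
exceeds≤1 (suc i) -[1+ _ ]    = +≤+ z≤n
exceeds≤1 zero    (+ zero)    = +≤+ z≤n
exceeds≤1 (suc i) (+ zero)    = +≤+ z≤n
exceeds≤1 zero    (+ (suc t)) = ℤ.≤-refl
exceeds≤1 (suc i) (+ (suc t)) = exceeds≤1 i (+ t)

exceeds-mono : ∀ i {s t} → s ℤ.≤ t → exceeds i s ℤ.≤ exceeds i t
exceeds-mono i       {s = -[1+ m ]}    {t} _ = neg i
  where
  neg : ∀ i → exceeds i -[1+ m ] ℤ.≤ exceeds i t
  neg zero    = 0≤exceeds zero t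
  neg (suc i) = 0≤exceeds (suc i) t
exceeds-mono i       {s = + zero}      {t} _ =
  subst (ℤ._≤ exceeds i t) (sym (exceeds-0 i)) (0≤exceeds i t)
exceeds-mono zero    {s = + (suc _)} (+≤+ (s≤s _))   = ℤ.≤-refl
exceeds-mono (suc i) {s = + (suc _)} (+≤+ (s≤s s≤t)) = exceeds-mono i (+≤+ s≤t)

exceeds-antitone : ∀ i t → exceeds (suc i) t ℤ.≤ exceeds i t
exceeds-antitone zero    -[1+ _ ]    = ℤ.≤-refl
exceeds-antitone (suc i) -[1+ _ ]    = ℤ.≤-refl
exceeds-antitone zero    (+ zero)    = ℤ.≤-refl
exceeds-antitone (suc i) (+ zero)    = ℤ.≤-refl
exceeds-antitone zero    (+ (suc t)) = exceeds≤1 zero (+ t)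
exceeds-antitone (suc i) (+ (suc t)) = exceeds-antitone i (+ t)

-- A rank increment `t` is spread over the first `t` layers, one unit each; `t ≤ k` guarantees that
-- there are enough layers.
sum-exceeds : ∀ {k t} → t ℕ.≤ k → sum {k} (λ i → exceeds (toℕ i) (+ t)) ≡ + t
sum-exceeds {zero}  z≤n       = refl
sum-exceeds {suc k} z≤n       = trans (ℤ.+-identityˡ _)
  (trans (sum-cong-≗ {k} (λ i → sym (exceeds-0 (toℕ i)))) (sum-exceeds {k} z≤n))
sum-exceeds {suc k} {suc t} (s≤s t≤k) = cong (λ z → 1ℤ + z) (sum-exceeds {k} {t} t≤k)

-- Quotients

∣p++q∣≡∣p∣+∣q∣ : ∀ {m n} (p : Subset m) (q : Subset n) → ∣ p ++ q ∣ ≡ ∣ p ∣ ℕ.+ ∣ q ∣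
∣p++q∣≡∣p∣+∣q∣ []            q = refl
∣p++q∣≡∣p∣+∣q∣ (outside ∷ p) q = ∣p++q∣≡∣p∣+∣q∣ p q
∣p++q∣≡∣p∣+∣q∣ (inside ∷ p)  q = cong suc (∣p++q∣≡∣p∣+∣q∣ p q)

∣p∪q∣+∣p∩q∣≡∣p∣+∣q∣ : ∀ {n} (p q : Subset n) → ∣ p ∪ q ∣ ℕ.+ ∣ p ∩ q ∣ ≡ ∣ p ∣ ℕ.+ ∣ q ∣
∣p∪q∣+∣p∩q∣≡∣p∣+∣q∣ []            []            = refl
∣p∪q∣+∣p∩q∣≡∣p∣+∣q∣ (outside ∷ p) (outside ∷ q) = ∣p∪q∣+∣p∩q∣≡∣p∣+∣q∣ p q
∣p∪q∣+∣p∩q∣≡∣p∣+∣q∣ (outside ∷ p) (inside ∷ q)  =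
  trans (cong suc (∣p∪q∣+∣p∩q∣≡∣p∣+∣q∣ p q)) (sym (ℕ.+-suc ∣ p ∣ ∣ q ∣))
∣p∪q∣+∣p∩q∣≡∣p∣+∣q∣ (inside ∷ p)  (outside ∷ q) = cong suc (∣p∪q∣+∣p∩q∣≡∣p∣+∣q∣ p q)
∣p∪q∣+∣p∩q∣≡∣p∣+∣q∣ (inside ∷ p)  (inside ∷ q)  =
  cong suc (trans (ℕ.+-suc ∣ p ∪ q ∣ ∣ p ∩ q ∣)
    (trans (cong suc (∣p∪q∣+∣p∩q∣≡∣p∣+∣q∣ p q)) (sym (ℕ.+-suc ∣ p ∣ ∣ q ∣))))

take-++ : ∀ {a} {A : Set a} {m n} (xs : Vec A m) (ys : Vec A n) → take m (xs ++ ys) ≡ xs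
take-++ {m = m} xs ys = ++-injectiveˡ (take m (xs ++ ys)) xs (take++drop≡id m (xs ++ ys))

drop-++ : ∀ {a} {A : Set a} {m n} (xs : Vec A m) (ys : Vec A n) → drop m (xs ++ ys) ≡ ys
drop-++ {m = m} xs ys =
  ++-injectiveʳ (take m (xs ++ ys)) xs (take++drop≡id m (xs ++ ys))

take-⊆ : ∀ {m n} {S T : Subset (m ℕ.+ n)} → S ⊆ T → take m S ⊆ take m T
take-⊆ {m} {S = S} {T} S⊆T =
  ∪≡⇒⊆ (trans (sym (take-zipWith _ S T)) (cong (take m) (⊆⇒∪≡ S⊆T)))

drop-⊆ : ∀ {m n} {S T : Subset (m ℕ.+ n)} → S ⊆ T → drop m S ⊆ drop m T
drop-⊆ {m} {S = S} {T} S⊆T =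
  ∪≡⇒⊆ (trans (sym (drop-zipWith {m = m} _ S T)) (cong (drop m) (⊆⇒∪≡ S⊆T)))

++-⊆ : ∀ {m n} {X Y : Subset m} {Z W : Subset n} → X ⊆ Y → Z ⊆ W → X ++ Z ⊆ Y ++ W
++-⊆ {X = X} {Y} {Z} {W} X⊆Y Z⊆W =
  ∪≡⇒⊆ (trans (zipWith-++ _ X Z Y W) (cong₂ _++_ (⊆⇒∪≡ X⊆Y) (⊆⇒∪≡ Z⊆W)))

-- The rank-function criterion for `Q` to be a quotient of `L`, that `r L - r Q` is non-decreasing,
-- written with increments. The order of the arguments is opposite to that of `IsQuotientOf`.
Steeper : ∀ {n} {E : Subset n} → Matroid E → Matroid E → Set
Steeper {E = E} L Q =
  ∀ {X Y} → X ⊆ Y → Y ⊆ E → r Q Y - r Q X ℤ.≤ r L Y - r L X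

-- In `M`, an increment from `X` to `Y` can only shrink once `A` has been added. The increment
-- without `A` is that of `L`, and the one with `A` is that of `Q`.
quotient⇒steeper : ∀ {n} {E : Subset n} (Q L : Matroid E) → IsQuotientOf Q L → Steeper L Q
quotient⇒steeper {n} {E} Q L (m , M , ranks) {X} {Y} X⊆Y Y⊆E =
  ≤-by-difference
    (diminishing {S = X ++ ⊥} {Y ++ ⊥} {A} (polymatroid M)
      (++-⊆ {Z = ⊥} {⊥} X⊆Y ⊥⊆) (++-⊆ {Z = ⊥} {⊤} Y⊆E ⊆⊤) (++-⊆ {X = ⊥} {E} {⊤ {m}} {⊤} ⊥⊆ ⊆⊤))
    (trans (rearrange (M-rank (Y ++ ⊥)) (M-rank (X ++ ⊥))
                      (M-rank ((X ++ ⊥) ∪ A)) (M-rank ((Y ++ ⊥) ∪ A)) (M-rank A))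
      (sym (cong₂ _-_
        (cong₂ _-_ (proj₁ (ranks Y⊆E)) (proj₁ (ranks X⊆E)))
        (cong₂ _-_ (proj₂ (ranks Y⊆E)) (proj₂ (ranks X⊆E))))))
  where
  X⊆E : X ⊆ E
  X⊆E x∈X = Y⊆E (X⊆Y x∈X)

  A = ⊥ {n} ++ ⊤ {m}
  M-rank = rank (polymatroid M)

  rearrange : ∀ y x xa ya a → (y + xa) - (ya + x) ≡ (y - x) - ((ya - a) - (xa - a))
  rearrange = solve-∀

-- The letters `S`, `T`, `U`, `I` index the values at two sets, their union and their intersection.
-- If both minima on the right are attained by the same function, its submodularity suffices.
-- Otherwise the union is bounded by `g` and the intersection by `f`, and steepness from the set
-- where `g` is chosen up to the union makes up the difference.
⊓-submodular : ∀ {fS fT fU fI gS gT gU gI : ℤ} →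
  fU + fI ℤ.≤ fS + fT → gU + gI ℤ.≤ gS + gT →
  gU - gS ℤ.≤ fU - fS → gU - gT ℤ.≤ fU - fT →
  fU ⊓ gU + fI ⊓ gI ℤ.≤ fS ⊓ gS + fT ⊓ gT
⊓-submodular {fS} {fT} {fU} {fI} {gS} {gT} {gU} {gI} f-sub g-sub steepS steepT
  with ℤ.⊓-sel fS gS | ℤ.⊓-sel fT gT
... | inj₁ S≡f | inj₁ T≡f rewrite S≡f | T≡f =
  ℤ.≤-trans (ℤ.+-mono-≤ (ℤ.i⊓j≤i fU gU) (ℤ.i⊓j≤i fI gI)) f-sub
... | inj₂ S≡g | inj₂ T≡g rewrite S≡g | T≡g =
  ℤ.≤-trans (ℤ.+-mono-≤ (ℤ.i⊓j≤j fU gU) (ℤ.i⊓j≤j fI gI)) g-sub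
... | inj₁ S≡f | inj₂ T≡g rewrite S≡f | T≡g =
  ℤ.≤-trans (ℤ.+-mono-≤ (ℤ.i⊓j≤j fU gU) (ℤ.i⊓j≤i fI gI))
    (≤-by-difference (ℤ.+-mono-≤ f-sub steepT) (rearrange fS fT fU fI gT gU))
  where
  rearrange : ∀ fS fT fU fI gT gU →
    ((fS + fT) + (fU - fT)) - ((fU + fI) + (gU - gT)) ≡ (fS + gT) - (gU + fI)
  rearrange = solve-∀
... | inj₂ S≡g | inj₁ T≡f rewrite S≡g | T≡f =
  ℤ.≤-trans (ℤ.+-mono-≤ (ℤ.i⊓j≤j fU gU) (ℤ.i⊓j≤i fI gI))
    (≤-by-difference (ℤ.+-mono-≤ f-sub steepS) (rearrange fS fT fU fI gS gU))
  where
  rearrange : ∀ fS fT fU fI gS gU →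
    ((fS + fT) + (fU - fS)) - ((fU + fI) + (gU - gS)) ≡ (gS + fT) - (gU + fI)
  rearrange = solve-∀

take-⊥ : ∀ m {n} → take m (⊥ {m ℕ.+ n}) ≡ ⊥
take-⊥ m {n} = ⊆-antisym
  (subst (take m ⊥ ⊆_) (take-++ (⊥ {m}) (⊥ {n})) (take-⊆ {m} {n} {⊥} {⊥ {m} ++ ⊥} ⊥⊆)) ⊥⊆

drop-⊥ : ∀ m {n} → drop m (⊥ {m ℕ.+ n}) ≡ ⊥
drop-⊥ m {n} = ⊆-antisym
  (subst (drop m ⊥ ⊆_) (drop-++ (⊥ {m}) (⊥ {n})) (drop-⊆ {m} {n} {⊥} {⊥ {m} ++ ⊥} ⊥⊆)) ⊥⊆

0≤rank : ∀ {n} {E X : Subset n} (ρ : Polymatroid E) → X ⊆ E → 0ℤ ℤ.≤ rank ρ X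
0≤rank ρ X⊆E = subst (ℤ._≤ rank ρ _) (normalized ρ) (monotone ρ ⊥⊆ X⊆E)

-- Higgs' construction: r(X ∪ Z) = min (r_L(X) + |Z|, r_Q(X) + |A|) for X ⊆ E
-- and Z ⊆ A, where |A| may be any upper bound of r_L - r_Q.
steeper⇒quotient : ∀ {n} {E : Subset n} (Q L : Matroid E) → Steeper L Q → IsQuotientOf Q L
-- The size `n` of `Fin n` serves as the size of `A`: it bounds `r L - r Q`, because
-- `r L X ≤ ∣ X ∣ ≤ n`.
steeper⇒quotient {n} {E} Q L steeper = n , M , λ X⊆E → deletion X⊆E , contraction X⊆E
  where
  f g M-rank : Subset (n ℕ.+ n) → ℤ
  f S      = r L (take n S) + + ∣ drop n S ∣
  g S      = r Q (take n S) + + n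
  M-rank S = f S ⊓ g S

  take⊆E : ∀ {S} → S ⊆ E ++ ⊤ → take n S ⊆ E
  take⊆E {S} S⊆ = subst (take n S ⊆_) (take-++ E ⊤) (take-⊆ {n} {n} {S} {E ++ ⊤} S⊆)

  drop-size-mono : ∀ {S T : Subset (n ℕ.+ n)} → S ⊆ T → + ∣ drop n S ∣ ℤ.≤ + ∣ drop n T ∣
  drop-size-mono {S} {T} S⊆T = +≤+ (p⊆q⇒∣p∣≤∣q∣ (drop-⊆ {n} {n} {S} {T} S⊆T))

  M-normalized : M-rank ⊥ ≡ 0ℤ
  M-normalized rewrite take-⊥ n {n} | drop-⊥ n {n} | ∣⊥∣≡0 n
                     | normalized (polymatroid L) | normalized (polymatroid Q) = refl

  M-monotone : ∀ {S T} → S ⊆ T → T ⊆ E ++ ⊤ → M-rank S ℤ.≤ M-rank T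
  M-monotone {S} {T} S⊆T T⊆ = ℤ.⊓-mono-≤
    (ℤ.+-mono-≤ (monotone (polymatroid L) take⊆ (take⊆E {T} T⊆)) (drop-size-mono {S} {T} S⊆T))
    (ℤ.+-monoˡ-≤ (+ n) (monotone (polymatroid Q) take⊆ (take⊆E {T} T⊆)))
    where
    take⊆ : take n S ⊆ take n T
    take⊆ = take-⊆ {n} {n} {S} {T} S⊆T

  -- From `S` to `T`, `g` gains only an increment of `r Q`, whereas `f` gains the larger increment
  -- of `r L` and the growth within `A`.
  steep : ∀ {S T} → S ⊆ T → T ⊆ E ++ ⊤ → g T - g S ℤ.≤ f T - f S
  steep {S} {T} S⊆T T⊆ = ≤-by-difference
    (ℤ.+-mono-≤ (steeper (take-⊆ {n} {n} {S} {T} S⊆T) (take⊆E {T} T⊆))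
                (drop-size-mono {S} {T} S⊆T))
    (rearrange (r L (take n S)) (r L (take n T)) (r Q (take n S)) (r Q (take n T))
               (+ ∣ drop n S ∣) (+ ∣ drop n T ∣) (+ n))
    where
    rearrange : ∀ lS lT qS qT dS dT m →
      ((lT - lS) + dT) - ((qT - qS) + dS) ≡ ((lT + dT) - (lS + dS)) - ((qT + m) - (qS + m))
    rearrange = solve-∀

  interchange : ∀ u i x y → (u + x) + (i + y) ≡ (u + i) + (x + y)
  interchange = solve-∀

  f-submodular : ∀ {S T} → S ⊆ E ++ ⊤ → T ⊆ E ++ ⊤ → f (S ∪ T) + f (S ∩ T) ℤ.≤ f S + f T
  f-submodular {S} {T} S⊆ T⊆
    rewrite take-zipWith {m = n} _∨_ S T | take-zipWith {m = n} _∧_ S T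
          | drop-zipWith {m = n} _∨_ S T | drop-zipWith {m = n} _∧_ S T =
    subst₂ ℤ._≤_
      (sym (interchange (r L (S₁ ∪ T₁)) (r L (S₁ ∩ T₁)) (+ ∣ S₂ ∪ T₂ ∣) (+ ∣ S₂ ∩ T₂ ∣)))
      (sym (interchange (r L S₁) (r L T₁) (+ ∣ S₂ ∣) (+ ∣ T₂ ∣)))
      (ℤ.+-mono-≤ (submodular (polymatroid L) (take⊆E {S} S⊆) (take⊆E {T} T⊆))
                  (ℤ.≤-reflexive (cong +_ (∣p∪q∣+∣p∩q∣≡∣p∣+∣q∣ S₂ T₂))))
    where
    S₁ = take n S
    S₂ = drop n S
    T₁ = take n T
    T₂ = drop n T

  g-submodular : ∀ {S T} → S ⊆ E ++ ⊤ → T ⊆ E ++ ⊤ → g (S ∪ T) + g (S ∩ T) ℤ.≤ g S + g T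
  g-submodular {S} {T} S⊆ T⊆
    rewrite take-zipWith {m = n} _∨_ S T | take-zipWith {m = n} _∧_ S T =
    subst₂ ℤ._≤_
      (sym (interchange (r Q (S₁ ∪ T₁)) (r Q (S₁ ∩ T₁)) (+ n) (+ n)))
      (sym (interchange (r Q S₁) (r Q T₁) (+ n) (+ n)))
      (ℤ.+-monoˡ-≤ _ (submodular (polymatroid Q) (take⊆E {S} S⊆) (take⊆E {T} T⊆)))
    where
    S₁ = take n S
    T₁ = take n T

  M-submodular : ∀ {S T} → S ⊆ E ++ ⊤ → T ⊆ E ++ ⊤ →
                 M-rank (S ∪ T) + M-rank (S ∩ T) ℤ.≤ M-rank S + M-rank T
  M-submodular {S} {T} S⊆ T⊆ =
    ⊓-submodular {f S} {f T} {f (S ∪ T)} {f (S ∩ T)} {g S} {g T} {g (S ∪ T)} {g (S ∩ T)}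
      (f-submodular {S} {T} S⊆ T⊆) (g-submodular {S} {T} S⊆ T⊆)
      (steep {S} {S ∪ T} (p⊆p∪q T) (∪-least S⊆ T⊆))
      (steep {T} {S ∪ T} (q⊆p∪q S T) (∪-least S⊆ T⊆))

  M-rank≤size : ∀ {S} → S ⊆ E ++ ⊤ → M-rank S ℤ.≤ + ∣ S ∣
  M-rank≤size {S} S⊆ = ℤ.≤-trans (ℤ.i⊓j≤i (f S) (g S))
    (subst (λ m → f S ℤ.≤ + m)
      (trans (sym (∣p++q∣≡∣p∣+∣q∣ (take n S) (drop n S))) (cong ∣_∣ (take++drop≡id n S)))
      (ℤ.+-monoˡ-≤ (+ ∣ drop n S ∣) (rank≤size L (take⊆E {S} S⊆))))

  M : Matroid (E ++ ⊤ {n})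
  M = record
    { polymatroid = record
      { rank       = M-rank
      ; normalized = M-normalized
      ; monotone   = λ {S} {T} → M-monotone {S} {T}
      ; submodular = λ {S} {T} → M-submodular {S} {T}
      }
    ; rank≤size = λ {S} → M-rank≤size {S}
    }

  M-rank-++ : ∀ X Z → M-rank (X ++ Z) ≡ (r L X + + ∣ Z ∣) ⊓ (r Q X + + n)
  M-rank-++ X Z = cong₂ (λ U V → (r L U + + ∣ V ∣) ⊓ (r Q U + + n)) (take-++ X Z) (drop-++ X Z)

  -- Once all of `A` is present, the second term is the minimum: steepness between `⊥` and `X` gives
  -- `r Q X ≤ r L X`.
  M-rank-∪A : ∀ {X} → X ⊆ E → M-rank (X ++ ⊤) ≡ r Q X + + n
  M-rank-∪A {X} X⊆E rewrite M-rank-++ X ⊤ | ∣⊤∣≡n n =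
    ℤ.i≥j⇒i⊓j≡j (ℤ.+-monoˡ-≤ (+ n)
      (subst₂ ℤ._≤_ (from-⊥ Q) (from-⊥ L) (steeper ⊥⊆ X⊆E)))
    where
    from-⊥ : (N : Matroid E) → r N X - r N ⊥ ≡ r N X
    from-⊥ N = trans (cong (λ z → r N X - z) (normalized (polymatroid N))) (ℤ.+-identityʳ (r N X))

  -- Without `A` the first term is the minimum: `r L X ≤ ∣ X ∣ ≤ n ≤ r Q X + n`.
  deletion : ∀ {X} → X ⊆ E → r L X ≡ M-rank (X ++ ⊥)
  deletion {X} X⊆E rewrite M-rank-++ X ⊥ | ∣⊥∣≡0 n | ℤ.+-identityʳ (r L X) =
    sym (ℤ.i≤j⇒i⊓j≡i
      (ℤ.≤-trans (rank≤size L X⊆E)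
        (ℤ.≤-trans (+≤+ (∣p∣≤n X)) (ℤ.+-monoˡ-≤ (+ n) (0≤rank (polymatroid Q) X⊆E)))))

  contraction : ∀ {X} → X ⊆ E →
    r Q X ≡ M-rank ((X ++ ⊥) ∪ (⊥ {n} ++ ⊤ {n})) - M-rank (⊥ {n} ++ ⊤)
  contraction {X} X⊆E = sym (trans
    (cong₂ _-_
      (trans (cong M-rank (trans (zipWith-++ _∨_ X ⊥ ⊥ ⊤)
                                 (cong₂ _++_ (∪-identityʳ X) (∪-identityˡ ⊤))))
             (M-rank-∪A X⊆E))
      (trans (M-rank-∪A ⊥⊆) (cong (_+ + n) (normalized (polymatroid Q)))))
    (cancel (r Q X) (+ n)))
    where
    cancel : ∀ x m → (x + m) - (0ℤ + m) ≡ x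
    cancel = solve-∀

-- Layers

-- The arguments are the ranks of `X`, `X ∪ e`, `X ∪ g` and `X ∪ e ∪ g`. Both pairs of marginals
-- have sum `z - u`, so they coincide as multisets as soon as `x - u` equals `y - u` or `z - y`.
Balanced : ℤ → ℤ → ℤ → ℤ → Set
Balanced u x y z = x ≡ y ⊎ x + y ≡ u + z

BalancedAt : ∀ {n} → (Subset n → ℤ) → Subset n → Fin n → Fin n → Set
BalancedAt f X e g =
  Balanced (f X) (f (X ∪ ⁅ e ⁆)) (f (X ∪ ⁅ g ⁆)) (f ((X ∪ ⁅ e ⁆) ∪ ⁅ g ⁆))

+≡+⇒-≡- : ∀ x y u z → x + y ≡ u + z → x - u ≡ z - y
+≡+⇒-≡- x y u z eq =
  trans (left x y u) (trans (cong (λ s → s - (u + y)) eq) (right y u z))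
  where
  left : ∀ x y u → x - u ≡ (x + y) - (u + y)
  left = solve-∀
  right : ∀ y u z → (u + z) - (u + y) ≡ z - y
  right = solve-∀

-- Layers are numbered from 0: layer `i` grows exactly when the increment of `f` is at least
-- `i + 1`.
layer-increment : ∀ {n} → (Subset n → ℤ) → ℕ → Fin n → Subset n → ℤ
layer-increment f i e X = exceeds i (f (X ∪ ⁅ e ⁆) - f X)

layer : ∀ {n} → (Subset n → ℤ) → ℕ → Subset n → ℤ
layer f i = potential (layer-increment f i)

-- Balance matches the two marginals of one path with those of the other, in the same order in the
-- first case and crosswise in the second. Applying `exceeds i` to each marginal preserves the
-- matching.
layer-increment-cocycle : ∀ {n} (f : Subset n → ℤ) i X e g → BalancedAt f X e g →
  layer-increment f i e X + layer-increment f i g (X ∪ ⁅ e ⁆) ≡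
  layer-increment f i g X + layer-increment f i e (X ∪ ⁅ g ⁆)
layer-increment-cocycle f i X e g (inj₁ x≡y) =
  cong₂ _+_ (cong (λ z → exceeds i (z - f X)) x≡y)
            (cong₂ (λ u v → exceeds i (u - v)) (cong f (∪-swap X ⁅ e ⁆ ⁅ g ⁆)) x≡y)
layer-increment-cocycle f i X e g (inj₂ x+y≡u+z) =
  trans (ℤ.+-comm (layer-increment f i e X) (layer-increment f i g (X ∪ ⁅ e ⁆)))
    (cong₂ _+_
      (cong (exceeds i) (sym (+≡+⇒-≡- y x u z (trans (ℤ.+-comm y x) x+y≡u+z))))
      (cong (exceeds i) (trans (+≡+⇒-≡- x y u z x+y≡u+z)
                               (cong (λ S → f S - y) (∪-swap X ⁅ e ⁆ ⁅ g ⁆)))))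
  where
  u = f X
  x = f (X ∪ ⁅ e ⁆)
  y = f (X ∪ ⁅ g ⁆)
  z = f ((X ∪ ⁅ e ⁆) ∪ ⁅ g ⁆)

module _ {n} (ρ : Polymatroid (⊤ {n}))
         (balanced : ∀ X e g → BalancedAt (rank ρ) X e g) where

  layer-∪ : ∀ i X e →
    layer (rank ρ) i (X ∪ ⁅ e ⁆) ≡ layer (rank ρ) i X + layer-increment (rank ρ) i e X
  layer-∪ i = potential-∪ (layer-increment (rank ρ) i)
    (λ X e g → layer-increment-cocycle (rank ρ) i X e g (balanced X e g))
    (λ {X} {e} e∈X → trans
      (cong (exceeds i)
        (trans (cong (λ S → rank ρ S - rank ρ X) (∪⁅⁆-absorb e∈X)) (ℤ.+-inverseʳ (rank ρ X))))
      (exceeds-0 i))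

  marginal-diminishing : ∀ {S T} e → S ⊆ T →
    rank ρ (T ∪ ⁅ e ⁆) - rank ρ T ℤ.≤ rank ρ (S ∪ ⁅ e ⁆) - rank ρ S
  marginal-diminishing {S} {T} e S⊆T = ≤-by-difference
    (diminishing {T = T} {⁅ e ⁆} ρ S⊆T ⊆⊤ ⊆⊤)
    (rearrange (rank ρ (T ∪ ⁅ e ⁆)) (rank ρ S) (rank ρ T) (rank ρ (S ∪ ⁅ e ⁆)))
    where
    rearrange : ∀ te s t se → (t + se) - (te + s) ≡ (se - s) - (te - t)
    rearrange = solve-∀

  -- The matroid axioms hold for all subsets of `Fin n`. The ground set `E` is a parameter so that
  -- the layers of an extension by loops can be read as matroids on the original ground set.
  layer-matroid : ℕ → (E : Subset n) → Matroid E
  layer-matroid i E = record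
    { polymatroid = record
      { rank       = layer (rank ρ) i
      ; normalized = potential-⊥ (layer-increment (rank ρ) i)
      ; monotone   = λ X⊆Y _ → increasing (layer (rank ρ) i) grows X⊆Y
      ; submodular = λ {X} {Y} _ _ → submodular-from-elements (layer (rank ρ) i) diminishes X Y
      }
    ; rank≤size = λ {X} _ →
        potential≤size (layer-increment (rank ρ) i)
          (λ e Y → exceeds≤1 i (rank ρ (Y ∪ ⁅ e ⁆) - rank ρ Y)) X
    }
    where
    grows : ∀ X e → layer (rank ρ) i X ℤ.≤ layer (rank ρ) i (X ∪ ⁅ e ⁆)
    grows X e = subst₂ ℤ._≤_ (ℤ.+-identityʳ _) (sym (layer-∪ i X e))
      (ℤ.+-monoʳ-≤ (layer (rank ρ) i X) (0≤exceeds i (rank ρ (X ∪ ⁅ e ⁆) - rank ρ X)))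

    diminishes : ∀ X e g → layer (rank ρ) i X - layer (rank ρ) i (X ∪ ⁅ e ⁆) ℤ.≤
      layer (rank ρ) i (X ∪ ⁅ g ⁆) - layer (rank ρ) i ((X ∪ ⁅ g ⁆) ∪ ⁅ e ⁆)
    diminishes X e g rewrite layer-∪ i X e | layer-∪ i (X ∪ ⁅ g ⁆) e =
      ≤-by-difference (exceeds-mono i (marginal-diminishing {X} {X ∪ ⁅ g ⁆} e (p⊆p∪q ⁅ g ⁆)))
        (rearrange (layer (rank ρ) i X) (layer (rank ρ) i (X ∪ ⁅ g ⁆))
          (layer-increment (rank ρ) i e X) (layer-increment (rank ρ) i e (X ∪ ⁅ g ⁆)))
      where
      rearrange : ∀ r s x y → x - y ≡ (s - (s + y)) - (r - (r + x))
      rearrange = solve-∀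

  -- By `exceeds-antitone`, each added element raises layer `i` at least as much as layer `suc i`,
  -- so their difference grows in one-element steps.
  layer-steeper : ∀ i E → Steeper (layer-matroid i E) (layer-matroid (suc i) E)
  layer-steeper i E {X} {Y} X⊆Y _ =
    ≤-by-difference (increasing gap grows X⊆Y)
      (rearrange (layer (rank ρ) i X) (layer (rank ρ) i Y)
                 (layer (rank ρ) (suc i) X) (layer (rank ρ) (suc i) Y))
    where
    gap : Subset n → ℤ
    gap Z = layer (rank ρ) i Z - layer (rank ρ) (suc i) Z

    rearrange : ∀ a b c d → (b - d) - (a - c) ≡ (b - a) - (d - c)
    rearrange = solve-∀

    grows : ∀ Z e → gap Z ℤ.≤ gap (Z ∪ ⁅ e ⁆)
    grows Z e rewrite layer-∪ i Z e | layer-∪ (suc i) Z e =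
      ≤-by-difference (exceeds-antitone i (rank ρ (Z ∪ ⁅ e ⁆) - rank ρ Z))
        (regroup (layer (rank ρ) i Z) (layer (rank ρ) (suc i) Z)
          (layer-increment (rank ρ) i e Z) (layer-increment (rank ρ) (suc i) e Z))
      where
      regroup : ∀ a b x y → x - y ≡ ((a + x) - (b + y)) - (a - b)
      regroup = solve-∀

  sum-layers : ∀ {k} → IsKPolymatroid k ρ → ∀ X →
               sum {k} (λ i → layer (rank ρ) (toℕ i) X) ≡ rank ρ X
  sum-layers {k} k-poly = subset-induction _ base step
    where
    sum-exceeds-ℤ : ∀ {t} → 0ℤ ℤ.≤ t → t ℤ.≤ + k → sum {k} (λ i → exceeds (toℕ i) t) ≡ t
    sum-exceeds-ℤ {+ t} _ (+≤+ t≤k) = sum-exceeds {k} {t} t≤k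

    base : sum {k} (λ i → layer (rank ρ) (toℕ i) ⊥) ≡ rank ρ ⊥
    base = trans
      (sum-cong-≗ {k} (λ i →
        trans (potential-⊥ (layer-increment (rank ρ) (toℕ i))) (sym (exceeds-0 (toℕ i)))))
      (trans (sum-exceeds {k} {0} z≤n) (sym (normalized ρ)))

    step : ∀ X e → sum {k} (λ i → layer (rank ρ) (toℕ i) X) ≡ rank ρ X →
           sum {k} (λ i → layer (rank ρ) (toℕ i) (X ∪ ⁅ e ⁆)) ≡ rank ρ (X ∪ ⁅ e ⁆)
    step X e ih = trans (sum-cong-≗ {k} (λ i → layer-∪ (toℕ i) X e))
      (trans (∑-distrib-+ {k} (λ i → layer (rank ρ) (toℕ i) X)
                              (λ i → layer-increment (rank ρ) (toℕ i) e X))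
      (trans (cong₂ _+_ ih (sum-exceeds-ℤ 0≤t t≤k))
             (cancel (rank ρ X) (rank ρ (X ∪ ⁅ e ⁆)))))
      where
      cancel : ∀ a b → a + (b - a) ≡ b
      cancel = solve-∀

      0≤t : 0ℤ ℤ.≤ rank ρ (X ∪ ⁅ e ⁆) - rank ρ X
      0≤t = ℤ.i≤j⇒0≤j-i (monotone ρ (p⊆p∪q ⁅ e ⁆) ⊆⊤)

      -- The marginals of `e` shrink as the set grows, so the one at `⊥`, which is `rank ρ ⁅ e ⁆`,
      -- bounds them all.
      t≤k : rank ρ (X ∪ ⁅ e ⁆) - rank ρ X ℤ.≤ + k
      t≤k = ℤ.≤-trans (marginal-diminishing {⊥} {X} e ⊥⊆)
        (subst (ℤ._≤ + k)
          (sym (trans (cong₂ (λ S z → rank ρ S - z) (∪-identityˡ ⁅ e ⁆) (normalized ρ))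
                      (ℤ.+-identityʳ _)))
          (k-poly e ∈⊤))

  layers-are-quotients : ∀ {k} E (i j : Fin k) → toℕ j ≡ suc (toℕ i) →
    IsQuotientOf (layer-matroid (toℕ j) E) (layer-matroid (toℕ i) E)
  layers-are-quotients E i j j≡1+i rewrite j≡1+i =
    steeper⇒quotient (layer-matroid (suc (toℕ i)) E) (layer-matroid (toℕ i) E)
                     (λ {X} {Y} → layer-steeper (toℕ i) E {X} {Y})

-- Arbitrary ground sets

∪⁅⁆-∩-∈ : ∀ {n} {E : Subset n} {e} X → e ∈ E → (X ∪ ⁅ e ⁆) ∩ E ≡ (X ∩ E) ∪ ⁅ e ⁆
∪⁅⁆-∩-∈ {E = E} {e} X e∈E =
  trans (∩-distribʳ-∪ E X ⁅ e ⁆) (cong ((X ∩ E) ∪_) (⊆⇒∩≡ (⁅⁆⊆ e∈E)))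

∪⁅⁆-∩-∉ : ∀ {n} {E : Subset n} {e} X → e ∉ E → (X ∪ ⁅ e ⁆) ∩ E ≡ X ∩ E
∪⁅⁆-∩-∉ {E = E} {e} X e∉E =
  trans (∩-distribʳ-∪ E X ⁅ e ⁆)
    (trans (cong ((X ∩ E) ∪_) (⊆-antisym disjoint ⊥⊆)) (∪-identityʳ (X ∩ E)))
  where
  disjoint : ⁅ e ⁆ ∩ E ⊆ ⊥
  disjoint x∈ with x∈p∩q⁻ ⁅ e ⁆ E x∈
  ... | x∈⁅e⁆ , x∈E = contradiction (subst (_∈ E) (x∈⁅y⁆⇒x≡y e x∈⁅e⁆) x∈E) e∉E

-- Layers are built by adding arbitrary elements of `Fin n`. Making the elements outside `E` loops
-- gives every subset of `Fin n` a meaningful rank.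
extend-by-loops : ∀ {n} {E : Subset n} → Polymatroid E → Polymatroid (⊤ {n})
extend-by-loops {E = E} ρ = record
  { rank       = λ X → rank ρ (X ∩ E)
  ; normalized = trans (cong (rank ρ) (∩-zeroˡ E)) (normalized ρ)
  ; monotone   = λ {X} {Y} X⊆Y _ → monotone ρ (∩-mono X Y X⊆Y) (p∩q⊆q Y E)
  ; submodular = λ {X} {Y} _ _ →
      subst (ℤ._≤ rank ρ (X ∩ E) + rank ρ (Y ∩ E))
        (sym (cong₂ (λ U V → rank ρ U + rank ρ V) (∩-distribʳ-∪ E X Y) (∩-∩-distrib X Y)))
        (submodular ρ (p∩q⊆q X E) (p∩q⊆q Y E))
  }
  where
  ∩-mono : ∀ X Y → X ⊆ Y → X ∩ E ⊆ Y ∩ E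
  ∩-mono X Y X⊆Y x∈ with x∈p∩q⁻ X E x∈
  ... | x∈X , x∈E = x∈p∩q⁺ (X⊆Y x∈X , x∈E)

  ∩-∩-distrib : ∀ X Y → (X ∩ Y) ∩ E ≡ (X ∩ E) ∩ (Y ∩ E)
  ∩-∩-distrib X Y = ⊆-antisym
    (λ x∈ → x∈p∩q⁺ (∩-mono (X ∩ Y) X (p∩q⊆p X Y) x∈ , ∩-mono (X ∩ Y) Y (p∩q⊆q X Y) x∈))
    (λ x∈ → let x∈XE , x∈YE = x∈p∩q⁻ (X ∩ E) (Y ∩ E) x∈ in
      x∈p∩q⁺ (x∈p∩q⁺ (p∩q⊆p X E x∈XE , p∩q⊆p Y E x∈YE) , p∩q⊆q X E x∈XE))

balanced⇒𝒬 : ∀ {n k} {E : Subset n} (ρ : Polymatroid E) → IsKPolymatroid k ρ →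
  (∀ {X e g} → X ⊆ E → e ∈ E → g ∈ E → BalancedAt (rank ρ) X e g) → 𝒬 k ρ
balanced⇒𝒬 {n} {k} {E} ρ k-poly balanced =
  (λ i → layer-matroid ρ⁺ loops-balanced (toℕ i) E) ,
  layers-are-quotients ρ⁺ loops-balanced E ,
  λ {X} X⊆E → sym (trans (sum-layers ρ⁺ loops-balanced {k} loops-k-poly X)
                        (cong (rank ρ) (⊆⇒∩≡ X⊆E)))
  where
  ρ⁺ : Polymatroid (⊤ {n})
  ρ⁺ = extend-by-loops ρ

  -- If `e` or `g` is a loop, adding it changes no rank, and the second alternative holds.
  loops-balanced : ∀ X e g → BalancedAt (rank ρ⁺) X e g
  loops-balanced X e g with e ∈? E | g ∈? E
  ... | yes e∈E | yes g∈E
    rewrite ∪⁅⁆-∩-∈ (X ∪ ⁅ e ⁆) g∈E | ∪⁅⁆-∩-∈ X e∈E | ∪⁅⁆-∩-∈ X g∈E =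
    balanced (p∩q⊆q X E) e∈E g∈E
  ... | no e∉E  | _
    rewrite ∪-swap X ⁅ e ⁆ ⁅ g ⁆ | ∪⁅⁆-∩-∉ (X ∪ ⁅ g ⁆) e∉E | ∪⁅⁆-∩-∉ X e∉E =
    inj₂ refl
  ... | yes _   | no g∉E
    rewrite ∪⁅⁆-∩-∉ (X ∪ ⁅ e ⁆) g∉E | ∪⁅⁆-∩-∉ X g∉E =
    inj₂ (ℤ.+-comm (rank ρ ((X ∪ ⁅ e ⁆) ∩ E)) (rank ρ (X ∩ E)))

  loops-k-poly : IsKPolymatroid k ρ⁺
  loops-k-poly e _ with e ∈? E
  ... | yes e∈E rewrite ⊆⇒∩≡ (⁅⁆⊆ e∈E) = k-poly e e∈E
  ... | no e∉E  =
    subst (ℤ._≤ + k)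
      (sym (trans (cong (rank ρ) (trans (cong (_∩ E) (sym (∪-identityˡ ⁅ e ⁆)))
                                 (trans (∪⁅⁆-∩-∉ ⊥ e∉E) (∩-zeroˡ E))))
                  (normalized ρ)))
      (+≤+ z≤n)

-- Members of 𝒬 are balanced

adjacent⇒all : ∀ {k} (R : Fin k → Fin k → Set) → (∀ i → R i i) →
  (∀ {i j l} → R i j → R j l → R i l) → (∀ i j → toℕ j ≡ suc (toℕ i) → R i j) →
  ∀ i j → toℕ i ℕ.≤ toℕ j → R i j
adjacent⇒all R R-refl R-trans adj zero zero    _ = R-refl zero
adjacent⇒all {suc (suc k)} R R-refl R-trans adj zero (suc j) _ =
  R-trans (adj zero (suc zero) refl)
    (adjacent⇒all (λ i l → R (suc i) (suc l)) (R-refl ∘ suc) R-trans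
      (λ i l eq → adj (suc i) (suc l) (cong suc eq)) zero j z≤n)
adjacent⇒all R R-refl R-trans adj (suc i) (suc j) (s≤s i≤j) =
  adjacent⇒all (λ h l → R (suc h) (suc l)) (R-refl ∘ suc) R-trans
    (λ h l eq → adj (suc h) (suc l) (cong suc eq)) i j i≤j

Antitone : ∀ {k} → (Fin k → ℤ) → Set
Antitone p = ∀ i j → toℕ i ℕ.≤ toℕ j → p j ℤ.≤ p i

-- If p′ i < p i for some i, then p i = q i = 1 and p′ i = q′ i = 0.  So up to i
-- both p and q are constantly 1, and from i on both p′ and q′ are constantly 0.
0-1-dichotomy : ∀ {k} (p q p′ q′ : Fin k → ℤ) →
  Antitone p → Antitone q → Antitone p′ → Antitone q′ →
  (∀ i → p i ℤ.≤ 1ℤ) → (∀ i → q i ℤ.≤ 1ℤ) →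
  (∀ i → 0ℤ ℤ.≤ p′ i) → (∀ i → 0ℤ ℤ.≤ q′ i) →
  (∀ i → p′ i ℤ.≤ p i) → (∀ i → p i + q′ i ≡ q i + p′ i) →
  (∀ i → p i ≡ q i) ⊎ (∀ i → p i ≡ p′ i)
0-1-dichotomy p q p′ q′ p↓ q↓ p′↓ q′↓ p≤1 q≤1 0≤p′ 0≤q′ p′≤p path
  with any? (λ i → p′ i ℤ.<? p i)
... | no ¬drop = inj₂ (λ i → ℤ.≤-antisym (ℤ.≮⇒≥ (λ lt → ¬drop (i , lt))) (p′≤p i))
... | yes (i , p′i<pi) = inj₁ agree
  where
  1≤pi : 1ℤ ℤ.≤ p i
  1≤pi = ℤ.i<j⇒suc[i]≤j (ℤ.≤-<-trans (0≤p′ i) p′i<pi)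

  p′i≤0 : p′ i ℤ.≤ 0ℤ
  p′i≤0 = ≤-by-difference (ℤ.i<j⇒suc[i]≤j (ℤ.<-≤-trans p′i<pi (p≤1 i))) (shift (p′ i))
    where
    shift : ∀ x → 1ℤ - (1ℤ + x) ≡ 0ℤ - x
    shift = solve-∀

  -- By `path`, `q i = p i + q′ i - p′ i ≥ 1 + 0 - 0`. Similarly
  -- `q′ i = q i + p′ i - p i ≤ 1 + 0 - 1` below.
  1≤qi : 1ℤ ℤ.≤ q i
  1≤qi = ≤-by-difference (ℤ.+-mono-≤ (ℤ.+-mono-≤ 1≤pi p′i≤0) (0≤q′ i))
    (trans (regroup (p i) (p′ i) (q′ i))
      (trans (cong (λ s → s - (1ℤ + p′ i)) (path i)) (cancel (q i) (p′ i))))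
    where
    regroup : ∀ a b c → (a + 0ℤ + c) - (1ℤ + b + 0ℤ) ≡ (a + c) - (1ℤ + b)
    regroup = solve-∀
    cancel : ∀ a b → (a + b) - (1ℤ + b) ≡ a - 1ℤ
    cancel = solve-∀

  q′i≤0 : q′ i ℤ.≤ 0ℤ
  q′i≤0 = ≤-by-difference (ℤ.+-mono-≤ (ℤ.+-mono-≤ 1≤pi p′i≤0) (q≤1 i))
    (trans (regroup (p i) (p′ i) (q i))
      (trans (cong (λ s → p i - s) (sym (path i))) (cancel (p i) (q′ i))))
    where
    regroup : ∀ a b c → (a + 0ℤ + 1ℤ) - (1ℤ + b + c) ≡ a - (c + b)
    regroup = solve-∀
    cancel : ∀ a b → a - (a + b) ≡ 0ℤ - b
    cancel = solve-∀

  agree : ∀ j → p j ≡ q j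
  agree j with ℕ.≤-total (toℕ j) (toℕ i)
  ... | inj₁ j≤i = trans (ℤ.≤-antisym (p≤1 j) (ℤ.≤-trans 1≤pi (p↓ j i j≤i)))
                         (sym (ℤ.≤-antisym (q≤1 j) (ℤ.≤-trans 1≤qi (q↓ j i j≤i))))
  ... | inj₂ i≤j = begin
    p j          ≡⟨ ℤ.+-identityʳ (p j) ⟨
    p j + 0ℤ     ≡⟨ cong (λ z → p j + z) q′j≡0 ⟨
    p j + q′ j   ≡⟨ path j ⟩
    q j + p′ j   ≡⟨ cong (λ z → q j + z) p′j≡0 ⟩
    q j + 0ℤ     ≡⟨ ℤ.+-identityʳ (q j) ⟩
    q j          ∎
    where
    open ≡-Reasoning
    p′j≡0 : p′ j ≡ 0ℤ
    p′j≡0 = ℤ.≤-antisym (ℤ.≤-trans (p′↓ i j i≤j) p′i≤0) (0≤p′ j)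
    q′j≡0 : q′ j ≡ 0ℤ
    q′j≡0 = ℤ.≤-antisym (ℤ.≤-trans (q′↓ i j i≤j) q′i≤0) (0≤q′ j)

matroid-marginal≤1 : ∀ {n} {E X : Subset n} {e} (M : Matroid E) → X ⊆ E → e ∈ E →
                     r M (X ∪ ⁅ e ⁆) - r M X ℤ.≤ 1ℤ
matroid-marginal≤1 {n} {E} {X} {e} M X⊆E e∈E = ≤-by-difference
  (ℤ.+-mono-≤ (diminishing {S = ⊥} {X} {⁅ e ⁆} (polymatroid M) ⊥⊆ X⊆E (⁅⁆⊆ e∈E)) unit)
  (trans (cong (λ z → (r M X + r M (⊥ ∪ ⁅ e ⁆) + 1ℤ) - (r M (X ∪ ⁅ e ⁆) + z + r M (⊥ ∪ ⁅ e ⁆)))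
               (normalized (polymatroid M)))
         (rearrange (r M X) (r M (⊥ ∪ ⁅ e ⁆)) (r M (X ∪ ⁅ e ⁆))))
  where
  unit : r M (⊥ ∪ ⁅ e ⁆) ℤ.≤ 1ℤ
  unit = subst₂ (λ S m → r M S ℤ.≤ + m) (sym (∪-identityˡ ⁅ e ⁆)) (∣⁅x⁆∣≡1 e)
                (rank≤size M (⁅⁆⊆ e∈E))

  rearrange : ∀ x s xe → (x + s + 1ℤ) - (xe + 0ℤ + s) ≡ 1ℤ - (xe - x)
  rearrange = solve-∀

-- Each single matroid is balanced because its marginals are 0 or 1, but the alternative could vary
-- with `i` and would then be lost in the sum. The quotient relations make the marginals antitone in
-- `i`, and `0-1-dichotomy` yields one alternative for all `i` at once, which survives summation.
𝒬⇒balanced : ∀ {n k} {E X : Subset n} {e g} (ρ : Polymatroid E) → 𝒬 k ρ →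
             X ⊆ E → e ∈ E → g ∈ E → BalancedAt (rank ρ) X e g
𝒬⇒balanced {n} {k} {E} {X} {e} {g} ρ (M , quotients , ranks) X⊆E e∈E g∈E = by-cases
  (0-1-dichotomy (λ i → x i - u i) (λ i → y i - u i) (λ i → z i - y i) (λ i → z i - x i)
    (λ i j i≤j → steeper i j i≤j X⊆Xe Xe⊆E)
    (λ i j i≤j → steeper i j i≤j X⊆Xg Xg⊆E)
    (λ i j i≤j → steeper i j i≤j Xg⊆Xeg Xeg⊆E)
    (λ i j i≤j → steeper i j i≤j Xe⊆Xeg Xeg⊆E)
    (λ i → matroid-marginal≤1 (M i) X⊆E e∈E)
    (λ i → matroid-marginal≤1 (M i) X⊆E g∈E)
    (λ i → ℤ.i≤j⇒0≤j-i (monotone (polymatroid (M i)) Xg⊆Xeg Xeg⊆E))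
    (λ i → ℤ.i≤j⇒0≤j-i (monotone (polymatroid (M i)) Xe⊆Xeg Xeg⊆E))
    marginal≤
    (λ i → paths (x i) (y i) (u i) (z i)))
  where
  Xe Xg Xeg : Subset n
  Xe  = X ∪ ⁅ e ⁆
  Xg  = X ∪ ⁅ g ⁆
  Xeg = Xe ∪ ⁅ g ⁆

  u x y z : Fin k → ℤ
  u i = r (M i) X
  x i = r (M i) Xe
  y i = r (M i) Xg
  z i = r (M i) Xeg

  Xe⊆E : Xe ⊆ E
  Xe⊆E = ∪-least X⊆E (⁅⁆⊆ e∈E)
  Xg⊆E : Xg ⊆ E
  Xg⊆E = ∪-least X⊆E (⁅⁆⊆ g∈E)
  Xeg⊆E : Xeg ⊆ E
  Xeg⊆E = ∪-least Xe⊆E (⁅⁆⊆ g∈E)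
  X⊆Xe : X ⊆ Xe
  X⊆Xe = p⊆p∪q ⁅ e ⁆
  X⊆Xg : X ⊆ Xg
  X⊆Xg = p⊆p∪q ⁅ g ⁆
  Xe⊆Xeg : Xe ⊆ Xeg
  Xe⊆Xeg = p⊆p∪q ⁅ g ⁆
  Xg⊆Xeg : Xg ⊆ Xeg
  Xg⊆Xeg = ∪-monoˡ-⊆ ⁅ g ⁆ X⊆Xe

  steeper : ∀ i j → toℕ i ℕ.≤ toℕ j → Steeper (M i) (M j)
  steeper = adjacent⇒all (λ i j → Steeper (M i) (M j))
    (λ i _ _ → ℤ.≤-refl)
    (λ ij jl S⊆T T⊆E → ℤ.≤-trans (jl S⊆T T⊆E) (ij S⊆T T⊆E))
    (λ i j eq → quotient⇒steeper (M j) (M i) (quotients i j eq))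

  marginal≤ : ∀ i → z i - y i ℤ.≤ x i - u i
  marginal≤ i = ≤-by-difference
    (subst (λ S → r (M i) S + u i ℤ.≤ y i + x i) (∪-swap X ⁅ g ⁆ ⁅ e ⁆)
      (diminishing {S = X} {Xg} {⁅ e ⁆} (polymatroid (M i)) X⊆Xg Xg⊆E (⁅⁆⊆ e∈E)))
    (rearrange (x i) (y i) (u i) (z i))
    where
    rearrange : ∀ x y u z → (y + x) - (z + u) ≡ (x - u) - (z - y)
    rearrange = solve-∀

  paths : ∀ x y u z → (x - u) + (z - x) ≡ (y - u) + (z - y)
  paths = solve-∀

  by-cases : (∀ i → x i - u i ≡ y i - u i) ⊎ (∀ i → x i - u i ≡ z i - y i) →
             BalancedAt (rank ρ) X e g
  by-cases (inj₁ eq) = inj₁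
    (trans (ranks Xe⊆E) (trans (sum-cong-≗ {k} (λ i → ∙-cancelʳ (ℤ.- u i) (x i) (y i) (eq i)))
                               (sym (ranks Xg⊆E))))
  by-cases (inj₂ eq) = inj₂ (begin
    rank ρ Xe + rank ρ Xg     ≡⟨ cong₂ _+_ (ranks Xe⊆E) (ranks Xg⊆E) ⟩
    sum x + sum y             ≡⟨ ∑-distrib-+ x y ⟨
    sum (λ i → x i + y i)     ≡⟨ sum-cong-≗ {k} moved ⟩
    sum (λ i → u i + z i)     ≡⟨ ∑-distrib-+ u z ⟩
    sum u + sum z             ≡⟨ cong₂ _+_ (ranks X⊆E) (ranks Xeg⊆E) ⟨
    rank ρ X + rank ρ Xeg     ∎)
    where
    open ≡-Reasoning
    split : ∀ x y u → x + y ≡ (x - u) + (y + u)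
    split = solve-∀
    join : ∀ z y u → (z - y) + (y + u) ≡ u + z
    join = solve-∀
    moved : ∀ i → x i + y i ≡ u i + z i
    moved i = trans (split (x i) (y i) (u i))
      (trans (cong (_+ (y i + u i)) (eq i)) (join (z i) (y i) (u i)))

-- Excluded minors

-- Contraction does not raise the rank of an element, so minors of `k`-polymatroids are
-- `k`-polymatroids. For a singleton `B` this is subadditivity on two elements.
minor-rank-⁅⁆≤ : ∀ {n} {E B : Subset n} {e} (ρ : Polymatroid E) → B ⊆ E → e ∈ E →
                 rank ρ (⁅ e ⁆ ∪ B) - rank ρ B ℤ.≤ rank ρ ⁅ e ⁆
minor-rank-⁅⁆≤ {E = E} {B} {e} ρ B⊆E e∈E = ≤-by-difference
  (subst₂ (λ U V → rank ρ U + rank ρ ⊥ ℤ.≤ rank ρ B + rank ρ V)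
    (∪-comm B ⁅ e ⁆) (∪-identityˡ ⁅ e ⁆)
    (diminishing {S = ⊥} {B} {⁅ e ⁆} ρ ⊥⊆ B⊆E (⁅⁆⊆ e∈E)))
  (trans (cong (λ z → (rank ρ B + rank ρ ⁅ e ⁆) - (rank ρ (⁅ e ⁆ ∪ B) + z)) (normalized ρ))
         (rearrange (rank ρ B) (rank ρ ⁅ e ⁆) (rank ρ (⁅ e ⁆ ∪ B))))
  where
  rearrange : ∀ b e eb → (b + e) - (eb + 0ℤ) ≡ e - (eb - b)
  rearrange = solve-∀

x∈p─q⇒x∉q : ∀ {n} {x : Fin n} (p q : Subset n) → x ∈ p ─ q → x ∉ q
x∈p─q⇒x∉q (_ ∷ p) (inside ∷ q) ()         here
x∈p─q⇒x∉q (_ ∷ p) (_ ∷ q)      (there x∈) (there x∈q) = x∈p─q⇒x∉q p q x∈ x∈q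

pick : ∀ {n} → Side → Fin n → Subset n
pick s x = if s then ⁅ x ⁆ else ⊥

-- A form of `ρ ≅ ρ[ A ]` without bijections: `e` and `g` are the elements in the roles of 0 and 1,
-- and `pick s e ∪ pick t g` runs through the subsets of the ground set.
record Copy {k n} (A : ThreeSubset k) {E : Subset n} (ρ : Polymatroid E) : Set where
  field
    e g   : Fin n
    e∈E   : e ∈ E
    g∈E   : g ∈ E
    e≢g   : e ≢ g
    cover : ∀ {x} → x ∈ E → x ≡ e ⊎ x ≡ g
    ranks : ∀ s t → rank ρ (pick s e ∪ pick t g) ≡ rank ρ[ A ] (s ∷ t ∷ [])

BalancedAt-⊥ : ∀ {n} {E : Subset n} {e g} (ρ : Polymatroid E) →
  BalancedAt (rank ρ) ⊥ e g ⇔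
  Balanced 0ℤ (rank ρ ⁅ e ⁆) (rank ρ ⁅ g ⁆) (rank ρ (⁅ e ⁆ ∪ ⁅ g ⁆))
BalancedAt-⊥ {e = e} {g} ρ
  rewrite ∪-identityˡ ⁅ e ⁆ | ∪-identityˡ ⁅ g ⁆ | normalized ρ = mk⇔ id id

module _ {k n} {A : ThreeSubset k} {E : Subset n} {ρ : Polymatroid E} (copy : Copy A ρ) where
  open Copy copy
  open ThreeSubset A

  -- Each strict inequality excludes one alternative: `b<c` the first and `a<b` the second.
  copy-unbalanced : ¬ BalancedAt (rank ρ) ⊥ e g
  copy-unbalanced balanced =
    impossible (subst Balanced₄ rank-e (Equivalence.to (BalancedAt-⊥ ρ) balanced))
    where
    Balanced₄ : ℤ → Set
    Balanced₄ x = Balanced 0ℤ x (rank ρ ⁅ g ⁆) (rank ρ (⁅ e ⁆ ∪ ⁅ g ⁆))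

    rank-e : rank ρ ⁅ e ⁆ ≡ + b
    rank-e = trans (cong (rank ρ) (sym (∪-identityʳ ⁅ e ⁆))) (ranks inside outside)

    rank-g : rank ρ ⁅ g ⁆ ≡ + c
    rank-g = trans (cong (rank ρ) (sym (∪-identityˡ ⁅ g ⁆))) (ranks outside inside)

    impossible : ¬ Balanced₄ (+ b)
    impossible bal with subst₂ (Balanced 0ℤ (+ b)) rank-g (ranks inside inside) bal
    ... | inj₁ b≡c     = ℕ.<⇒≢ b<c (ℤ.+-injective b≡c)
    ... | inj₂ b+c≡a+c =
      ℕ.<⇒≢ a<b (sym (ℕ.+-cancelʳ-≡ c b a (ℤ.+-injective (trans b+c≡a+c (ℤ.+-identityˡ _)))))

  -- A proper minor has lost one of two elements. Any two of its elements are therefore equal, and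
  -- the first alternative of `Balanced` holds trivially.
  copy⇒excluded : IsKPolymatroid k ρ → IsExcludedMinor k ρ
  copy⇒excluded k-poly =
    (λ ρ∈𝒬 → copy-unbalanced (𝒬⇒balanced ρ ρ∈𝒬 ⊥⊆ e∈E g∈E)) ,
    minors
    where
    minors : ∀ U B → U ⊆ E → (B⊆ : B ⊆ E ─ U) → Nonempty (U ∪ B) →
             𝒬 k (contract (delete ρ U) B B⊆)
    minors U B U⊆E B⊆ (z , z∈) = balanced⇒𝒬 σ σ-k-poly
      (λ x∈X e∈G g∈G → inj₁ (cong (λ x → rank σ (_ ∪ ⁅ x ⁆)) (unique e∈G g∈G)))
      where
      σ = contract (delete ρ U) B B⊆

      G : Subset n
      G = (E ─ U) ─ B

      G⊆E : G ⊆ E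
      G⊆E x∈G = p─q⊆p E U (p─q⊆p (E ─ U) B x∈G)

      B⊆E : B ⊆ E
      B⊆E x∈B = p─q⊆p E U (B⊆ x∈B)

      σ-k-poly : IsKPolymatroid k σ
      σ-k-poly x x∈G = ℤ.≤-trans (minor-rank-⁅⁆≤ ρ B⊆E (G⊆E x∈G)) (k-poly x (G⊆E x∈G))

      z∉G : z ∉ G
      z∉G z∈G with x∈p∪q⁻ U B z∈
      ... | inj₁ z∈U = x∈p─q⇒x∉q E U (p─q⊆p (E ─ U) B z∈G) z∈U
      ... | inj₂ z∈B = x∈p─q⇒x∉q (E ─ U) B z∈G z∈B

      unique : ∀ {x y} → x ∈ G → y ∈ G → x ≡ y
      unique x∈G y∈G with cover (∪-least U⊆E B⊆E z∈) | cover (G⊆E x∈G) | cover (G⊆E y∈G)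
      ... | _         | inj₁ refl | inj₁ refl = refl
      ... | _         | inj₂ refl | inj₂ refl = refl
      ... | inj₁ refl | inj₁ refl | _         = contradiction x∈G z∉G
      ... | inj₁ refl | _         | inj₁ refl = contradiction y∈G z∉G
      ... | inj₂ refl | inj₂ refl | _         = contradiction x∈G z∉G
      ... | inj₂ refl | _         | inj₂ refl = contradiction y∈G z∉G

balancedAt? : ∀ {n} (f : Subset n → ℤ) X e g → Dec (BalancedAt f X e g)
balancedAt? f X e g =
  (f (X ∪ ⁅ e ⁆) ℤ.≟ f (X ∪ ⁅ g ⁆)) ⊎-dec
  (f (X ∪ ⁅ e ⁆) + f (X ∪ ⁅ g ⁆) ℤ.≟ f X + f ((X ∪ ⁅ e ⁆) ∪ ⁅ g ⁆))

-- Balance is decidable and there are finitely many triples, so a violation can be found by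
-- exhaustive search; `ρ∉𝒬` rules out that the search fails.
excluded⇒unbalanced : ∀ {n k} {E : Subset n} (ρ : Polymatroid E) → IsKPolymatroid k ρ →
  ¬ 𝒬 k ρ → ∃[ X ] ∃[ e ] ∃[ g ]
    (X ⊆ E × e ∈ E × g ∈ E × ¬ BalancedAt (rank ρ) X e g)
excluded⇒unbalanced {E = E} ρ k-poly ρ∉𝒬
  with anySubset? (λ X → any? (λ e → any? (λ g →
         (X ⊆? E) ×-dec (e ∈? E) ×-dec (g ∈? E) ×-dec ¬? (balancedAt? (rank ρ) X e g))))
... | yes found = found
... | no ¬found = contradiction
  (balanced⇒𝒬 ρ k-poly (λ {X} {e} {g} X⊆E e∈E g∈E → decidable-stable
    (balancedAt? (rank ρ) X e g) (λ ¬bal → ¬found (X , e , g , X⊆E , e∈E , g∈E , ¬bal))))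
  ρ∉𝒬

∃+ : ∀ {i} → 0ℤ ℤ.≤ i → ∃[ m ] i ≡ + m
∃+ {+ m} _ = m , refl

-- The parameters are `b = ρ(e)`, `c = ρ(g)` and `a = ρ(eg) - ρ(g)`. The two strict inequalities
-- become `b < c` and `a < b`, and the first also separates `e` from `g`.
copy-from-ranks : ∀ {n k} {E : Subset n} {e g} (ρ : Polymatroid E) → IsKPolymatroid k ρ →
  e ∈ E → g ∈ E → (∀ {x} → x ∈ E → x ≡ e ⊎ x ≡ g) →
  rank ρ ⁅ e ⁆ ℤ.< rank ρ ⁅ g ⁆ →
  rank ρ (⁅ e ⁆ ∪ ⁅ g ⁆) ℤ.< rank ρ ⁅ e ⁆ + rank ρ ⁅ g ⁆ →
  Σ[ A ∈ ThreeSubset k ] Copy A ρ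
copy-from-ranks {n} {k} {E} {e} {g} ρ k-poly e∈E g∈E cover e<g drop
  with ∃+ (0≤rank ρ (⁅⁆⊆ e∈E)) | ∃+ (0≤rank ρ (⁅⁆⊆ g∈E))
     | ∃+ (ℤ.i≤j⇒0≤j-i (monotone ρ (q⊆p∪q ⁅ e ⁆ ⁅ g ⁆) (∪-least (⁅⁆⊆ e∈E) (⁅⁆⊆ g∈E))))
... | b , rank-e | c , rank-g | a , rank-gap = A , record
  { e = e ; g = g ; e∈E = e∈E ; g∈E = g∈E ; cover = cover ; ranks = ranks
  ; e≢g = λ e≡g → ℤ.<-irrefl (cong (λ x → rank ρ ⁅ x ⁆) e≡g) e<g
  }
  where
  rank-eg : rank ρ (⁅ e ⁆ ∪ ⁅ g ⁆) ≡ + (a ℕ.+ c)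
  rank-eg = trans (uncancel (rank ρ (⁅ e ⁆ ∪ ⁅ g ⁆)) (rank ρ ⁅ g ⁆)) (cong₂ _+_ rank-gap rank-g)
    where
    uncancel : ∀ x y → x ≡ (x - y) + y
    uncancel = solve-∀

  A : ThreeSubset k
  A = record
    { a = a ; b = b ; c = c
    ; a<b = ℕ.+-cancelʳ-< c a b (ℤ.drop‿+<+ (subst₂ ℤ._<_ rank-eg (cong₂ _+_ rank-e rank-g) drop))
    ; b<c = ℤ.drop‿+<+ (subst₂ ℤ._<_ rank-e rank-g e<g)
    ; c≤k = ℤ.drop‿+≤+ (subst (ℤ._≤ + k) rank-g (k-poly g g∈E))
    }

  ranks : ∀ s t → rank ρ (pick s e ∪ pick t g) ≡ rank ρ[ A ] (s ∷ t ∷ [])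
  ranks outside outside = trans (cong (rank ρ) (∪-identityˡ ⊥)) (normalized ρ)
  ranks inside  outside = trans (cong (rank ρ) (∪-identityʳ ⁅ e ⁆)) rank-e
  ranks outside inside  = trans (cong (rank ρ) (∪-identityˡ ⁅ g ⁆)) rank-g
  ranks inside  inside  = rank-eg

excluded⇒copy : ∀ {n k} {E : Subset n} (ρ : Polymatroid E) → IsKPolymatroid k ρ →
                IsExcludedMinor k ρ → Σ[ A ∈ ThreeSubset k ] Copy A ρ
excluded⇒copy {n} {k} {E} ρ k-poly (ρ∉𝒬 , minors) with excluded⇒unbalanced ρ k-poly ρ∉𝒬
... | X , e , g , X⊆E , e∈E , g∈E , unbalanced = compare
  where
  -- All of `E` except `e`, `g` and `X`: deleting `U` and contracting `X` leaves only `e` and `g`.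
  U : Subset n
  U = (E ─ (⁅ e ⁆ ∪ ⁅ g ⁆)) ─ X

  U⊆E : U ⊆ E
  U⊆E x∈U = p─q⊆p E (⁅ e ⁆ ∪ ⁅ g ⁆) (p─q⊆p _ X x∈U)

  ∉U : ∀ {x} → x ∈ ⁅ e ⁆ ∪ ⁅ g ⁆ → x ∉ U
  ∉U x∈eg x∈U = x∈p─q⇒x∉q E (⁅ e ⁆ ∪ ⁅ g ⁆) (p─q⊆p _ X x∈U) x∈eg

  X⊆ : X ⊆ E ─ U
  X⊆ x∈X = x∈p∧x∉q⇒x∈p─q (X⊆E x∈X) (λ x∈U → x∈p─q⇒x∉q _ X x∈U x∈X)

  -- If `e` were in `X`, adding it would change no rank and the second alternative would hold; the
  -- same applies to `g`.
  e∉X : e ∉ X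
  e∉X e∈X = unbalanced (inj₂ (cong₂ _+_ (cong (rank ρ) X∪e≡X)
                                        (cong (λ S → rank ρ (S ∪ ⁅ g ⁆)) (sym X∪e≡X))))
    where
    X∪e≡X = ∪⁅⁆-absorb e∈X

  g∉X : g ∉ X
  g∉X g∈X = unbalanced (inj₂ (trans (ℤ.+-comm (rank ρ (X ∪ ⁅ e ⁆)) _) (cong₂ _+_
    (cong (rank ρ) (∪⁅⁆-absorb g∈X))
    (cong (rank ρ) (sym (∪⁅⁆-absorb (p⊆p∪q ⁅ e ⁆ g∈X)))))))

  -- If `U ∪ X` had an element, the minor would be proper, hence in `𝒬` and balanced at `⊥`, which
  -- makes `ρ` balanced at `X`.
  empty : ∀ {x} → x ∉ U ∪ X
  empty x∈ = unbalanced (uncontract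
    (𝒬⇒balanced (contract (delete ρ U) X X⊆) (minors U X U⊆E X⊆ (_ , x∈)) ⊥⊆
      (remains e∈E (p⊆p∪q ⁅ g ⁆ (x∈⁅x⁆ e)) e∉X) (remains g∈E (q⊆p∪q ⁅ e ⁆ ⁅ g ⁆ (x∈⁅x⁆ g)) g∉X)))
    where
    remains : ∀ {x} → x ∈ E → x ∈ ⁅ e ⁆ ∪ ⁅ g ⁆ → x ∉ X → x ∈ (E ─ U) ─ X
    remains x∈E x∈eg = x∈p∧x∉q⇒x∈p─q (x∈p∧x∉q⇒x∈p─q x∈E (∉U x∈eg))

    ⊥∪-∪X : ∀ S → (⊥ ∪ S) ∪ X ≡ X ∪ S
    ⊥∪-∪X S = trans (cong (_∪ X) (∪-identityˡ S)) (∪-comm S X)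

    -- Contracting `X` subtracts one constant from all four ranks, which affects neither
    -- alternative.
    uncontract : BalancedAt (λ S → rank ρ (S ∪ X) - rank ρ X) ⊥ e g → BalancedAt (rank ρ) X e g
    uncontract rewrite ∪-swap (⊥ ∪ ⁅ e ⁆) ⁅ g ⁆ X | ⊥∪-∪X ⁅ e ⁆ | ⊥∪-∪X ⁅ g ⁆ | ∪-identityˡ X =
      unshift (rank ρ X) (rank ρ X) (rank ρ (X ∪ ⁅ e ⁆)) (rank ρ (X ∪ ⁅ g ⁆))
              (rank ρ ((X ∪ ⁅ e ⁆) ∪ ⁅ g ⁆))
      where
      unshift : ∀ w u x y z → Balanced (u - w) (x - w) (y - w) (z - w) → Balanced u x y z
      unshift w u x y z (inj₁ eq) = inj₁ (∙-cancelʳ (ℤ.- w) x y eq)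
      unshift w u x y z (inj₂ eq) =
        inj₂ (∙-cancelʳ (ℤ.- w - w) (x + y) (u + z)
          (trans (regroup x y w) (trans eq (sym (regroup u z w)))))
        where
        regroup : ∀ x y w → (x + y) + (ℤ.- w - w) ≡ (x - w) + (y - w)
        regroup = solve-∀

  X≡⊥ : X ≡ ⊥
  X≡⊥ = Empty-unique (λ (x , x∈X) → empty (q⊆p∪q U X x∈X))

  cover : ∀ {x} → x ∈ E → x ≡ e ⊎ x ≡ g
  cover {x} x∈E with x ∈? ⁅ e ⁆ ∪ ⁅ g ⁆ | x ∈? X
  ... | _        | yes x∈X = contradiction (q⊆p∪q U X x∈X) empty
  ... | no x∉    | no x∉X  =
    contradiction (p⊆p∪q X (x∈p∧x∉q⇒x∈p─q (x∈p∧x∉q⇒x∈p─q x∈E x∉) x∉X)) empty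
  ... | yes x∈eg | no _    with x∈p∪q⁻ ⁅ e ⁆ ⁅ g ⁆ x∈eg
  ...   | inj₁ x∈e = inj₁ (x∈⁅y⁆⇒x≡y e x∈e)
  ...   | inj₂ x∈g = inj₂ (x∈⁅y⁆⇒x≡y g x∈g)

  unbalanced-⊥ : ¬ Balanced 0ℤ (rank ρ ⁅ e ⁆) (rank ρ ⁅ g ⁆) (rank ρ (⁅ e ⁆ ∪ ⁅ g ⁆))
  unbalanced-⊥ bal = unbalanced
    (subst (λ S → BalancedAt (rank ρ) S e g) (sym X≡⊥)
      (Equivalence.from (BalancedAt-⊥ ρ) bal))

  -- Submodularity gives `≤`, and equality would be the second alternative of `Balanced`.
  rank-eg< : rank ρ (⁅ e ⁆ ∪ ⁅ g ⁆) ℤ.< rank ρ ⁅ e ⁆ + rank ρ ⁅ g ⁆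
  rank-eg< = ℤ.≤∧≢⇒<
    (≤-by-difference (minor-rank-⁅⁆≤ ρ (⁅⁆⊆ g∈E) e∈E)
      (rearrange (rank ρ ⁅ e ⁆) (rank ρ ⁅ g ⁆) (rank ρ (⁅ e ⁆ ∪ ⁅ g ⁆))))
    (λ eq → unbalanced-⊥ (inj₂ (trans (sym eq) (sym (ℤ.+-identityˡ _)))))
    where
    rearrange : ∀ x y z → x - (z - y) ≡ (x + y) - z
    rearrange = solve-∀

  -- Equal ranks would be the first alternative; otherwise the element of smaller rank takes the
  -- role of 0.
  compare : Σ[ A ∈ ThreeSubset k ] Copy A ρ
  compare with ℤ.<-cmp (rank ρ ⁅ e ⁆) (rank ρ ⁅ g ⁆)
  ... | tri< e<g _ _ = copy-from-ranks ρ k-poly e∈E g∈E cover e<g rank-eg<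
  ... | tri≈ _ e≡g _ = contradiction (inj₁ e≡g) unbalanced-⊥
  ... | tri> _ _ g<e = copy-from-ranks ρ k-poly g∈E e∈E (swap ∘ cover) g<e
    (subst₂ ℤ._<_ (cong (rank ρ) (∪-comm ⁅ e ⁆ ⁅ g ⁆)) (ℤ.+-comm (rank ρ ⁅ e ⁆) (rank ρ ⁅ g ⁆))
                  rank-eg<)

-- Isomorphism with ρ[ A ]

Elements-≡ : ∀ {n} {E : Subset n} {x y : Elements E} → proj₁ x ≡ proj₁ y → x ≡ y
Elements-≡ {x = x , x∈E} {.x , x∈E′} refl = cong (x ,_) ([]=-irrelevant x∈E x∈E′)

lookup-≡ : ∀ {m n} {X : Subset m} {Y : Subset n} x y → x ∈ X ⇔ y ∈ Y → lookup X x ≡ lookup Y y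
lookup-≡ {X = X} {Y} x y x∈X⇔y∈Y with lookup X x in x≡ | lookup Y y in y≡
... | inside  | inside  = refl
... | outside | outside = refl
... | inside  | outside =
  trans (sym ([]=⇒lookup (Equivalence.to x∈X⇔y∈Y (lookup⇒[]= x X x≡)))) y≡
... | outside | inside  =
  trans (sym x≡) ([]=⇒lookup (Equivalence.from x∈X⇔y∈Y (lookup⇒[]= y Y y≡)))

∈-pick : ∀ {n} s (x : Fin n) {y} → y ∈ pick s x → y ≡ x × s ≡ inside
∈-pick inside  x y∈ = x∈⁅y⁆⇒x≡y x y∈ , refl
∈-pick outside x y∈ = contradiction y∈ ∉⊥

module _ {k n} {A : ThreeSubset k} {E : Subset n} {ρ : Polymatroid E} where

  copy⇒≅ : Copy A ρ → ρ ≅ ρ[ A ]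
  copy⇒≅ copy = mk↔ₛ′ to from to∘from from∘to , rank-preserving
    where
    open Copy copy

    to : Elements E → Elements (⊤ {2})
    to (x , _) with x Fin.≟ e
    ... | yes _ = zero , ∈⊤
    ... | no  _ = suc zero , ∈⊤

    from : Elements (⊤ {2}) → Elements E
    from (zero     , _) = e , e∈E
    from (suc zero , _) = g , g∈E

    to-e : proj₁ (to (e , e∈E)) ≡ zero
    to-e with e Fin.≟ e
    ... | yes _  = refl
    ... | no e≢e = contradiction refl e≢e

    to-g : proj₁ (to (g , g∈E)) ≡ suc zero
    to-g with g Fin.≟ e
    ... | yes g≡e = contradiction (sym g≡e) e≢g
    ... | no _    = refl

    to∘from : ∀ y → to (from y) ≡ y
    to∘from (zero     , _) = Elements-≡ to-e
    to∘from (suc zero , _) = Elements-≡ to-g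

    from∘to : ∀ x → from (to x) ≡ x
    from∘to (x , x∈E) with x Fin.≟ e
    ... | yes x≡e = Elements-≡ (sym x≡e)
    ... | no x≢e with cover x∈E
    ...   | inj₁ x≡e = contradiction x≡e x≢e
    ...   | inj₂ x≡g = Elements-≡ (sym x≡g)

    pick-lookup : ∀ {x} X → pick (lookup X x) x ⊆ X
    pick-lookup {x} X y∈ with ∈-pick (lookup X x) x y∈
    ... | refl , X[x] = lookup⇒[]= x X X[x]

    ∈-pick-lookup : ∀ {x} X → x ∈ X → x ∈ pick (lookup X x) x
    ∈-pick-lookup {x} X x∈X rewrite []=⇒lookup x∈X = x∈⁅x⁆ x

    two-elements : ∀ {X} → X ⊆ E → X ≡ pick (lookup X e) e ∪ pick (lookup X g) g
    two-elements {X} X⊆E =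
      ⊆-antisym split (∪-least {p = pick (lookup X e) e} (pick-lookup X) (pick-lookup X))
      where
      split : X ⊆ pick (lookup X e) e ∪ pick (lookup X g) g
      split x∈X with cover (X⊆E x∈X)
      ... | inj₁ refl = p⊆p∪q (pick (lookup X g) g) (∈-pick-lookup X x∈X)
      ... | inj₂ refl = q⊆p∪q (pick (lookup X e) e) (pick (lookup X g) g) (∈-pick-lookup X x∈X)

    rank-preserving : ∀ {X Y} → X ⊆ E → Y ⊆ ⊤ → (∀ x → proj₁ x ∈ X ⇔ proj₁ (to x) ∈ Y) →
                      rank ρ X ≡ rank ρ[ A ] Y
    rank-preserving {X} {s ∷ t ∷ []} X⊆E _ image =
      trans (cong (rank ρ) (trans (two-elements X⊆E)
                                  (cong₂ (λ s t → pick s e ∪ pick t g) X[e] X[g])))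
            (ranks s t)
      where
      X[e] : lookup X e ≡ s
      X[e] = lookup-≡ e zero (subst (λ y → e ∈ X ⇔ y ∈ s ∷ t ∷ []) to-e (image (e , e∈E)))
      X[g] : lookup X g ≡ t
      X[g] = lookup-≡ g (suc zero) (subst (λ y → g ∈ X ⇔ y ∈ s ∷ t ∷ []) to-g (image (g , g∈E)))

  ≅⇒copy : ρ ≅ ρ[ A ] → Copy A ρ
  ≅⇒copy (φ , rank-preserving) = record
    { e = e ; g = g ; e∈E = e∈E ; g∈E = g∈E ; e≢g = e≢g
    ; cover = λ x∈E → cover (_ , x∈E)
    ; ranks = λ s t → rank-preserving (∪-least (pick⊆E s e∈E) (pick⊆E t g∈E)) ⊆⊤ (image s t)
    }
    where
    open Inverse φ

    e g : Fin n
    e = proj₁ (from (zero , ∈⊤))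
    g = proj₁ (from (suc zero , ∈⊤))

    e∈E : e ∈ E
    e∈E = proj₂ (from (zero , ∈⊤))
    g∈E : g ∈ E
    g∈E = proj₂ (from (suc zero , ∈⊤))

    e≢g : e ≢ g
    e≢g e≡g with trans (sym (strictlyInverseˡ (zero , ∈⊤)))
                   (trans (cong to (Elements-≡ {x = from (zero , ∈⊤)} e≡g))
                          (strictlyInverseˡ (suc zero , ∈⊤)))
    ... | ()

    -- Recording the image along with the element reduces `image` to the two cases `image-e` and
    -- `image-g`.
    cover-to : ∀ x → (proj₁ x ≡ e × proj₁ (to x) ≡ zero) ⊎ (proj₁ x ≡ g × proj₁ (to x) ≡ suc zero)
    cover-to x with to x in to-x
    ... | zero , p = inj₁ (cong proj₁ (trans (sym (strictlyInverseʳ x))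
      (cong from (trans to-x (Elements-≡ refl)))) , refl)
    ... | suc zero , p = inj₂ (cong proj₁ (trans (sym (strictlyInverseʳ x))
      (cong from (trans to-x (Elements-≡ refl)))) , refl)

    cover : ∀ x → proj₁ x ≡ e ⊎ proj₁ x ≡ g
    cover x with cover-to x
    ... | inj₁ (x≡e , _) = inj₁ x≡e
    ... | inj₂ (x≡g , _) = inj₂ x≡g

    pick⊆E : ∀ s {x} → x ∈ E → pick s x ⊆ E
    pick⊆E s {x} x∈E y∈ with ∈-pick s x y∈
    ... | refl , _ = x∈E

    image-e : ∀ s t → e ∈ pick s e ∪ pick t g ⇔ zero ∈ s ∷ t ∷ []
    image-e s t = mk⇔ to-0 from-0
      where
      to-0 : e ∈ pick s e ∪ pick t g → zero ∈ s ∷ t ∷ []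
      to-0 e∈ with x∈p∪q⁻ (pick s e) (pick t g) e∈
      ... | inj₁ e∈s rewrite proj₂ (∈-pick s e e∈s) = here
      ... | inj₂ e∈t = contradiction (proj₁ (∈-pick t g e∈t)) e≢g
      from-0 : zero ∈ s ∷ t ∷ [] → e ∈ pick s e ∪ pick t g
      from-0 here = p⊆p∪q (pick t g) (x∈⁅x⁆ e)

    image-g : ∀ s t → g ∈ pick s e ∪ pick t g ⇔ suc zero ∈ s ∷ t ∷ []
    image-g s t = mk⇔ to-1 from-1
      where
      to-1 : g ∈ pick s e ∪ pick t g → suc zero ∈ s ∷ t ∷ []
      to-1 g∈ with x∈p∪q⁻ (pick s e) (pick t g) g∈
      ... | inj₁ g∈s = contradiction (sym (proj₁ (∈-pick s e g∈s))) e≢g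
      ... | inj₂ g∈t rewrite proj₂ (∈-pick t g g∈t) = there here
      from-1 : suc zero ∈ s ∷ t ∷ [] → g ∈ pick s e ∪ pick t g
      from-1 (there here) = q⊆p∪q (pick s e) (pick t g) (x∈⁅x⁆ g)

    image : ∀ s t x → proj₁ x ∈ pick s e ∪ pick t g ⇔ proj₁ (to x) ∈ s ∷ t ∷ []
    image s t x with cover-to x
    ... | inj₁ (x≡e , to-x) =
      subst₂ (λ x y → x ∈ pick s e ∪ pick t g ⇔ y ∈ s ∷ t ∷ []) (sym x≡e) (sym to-x) (image-e s t)
    ... | inj₂ (x≡g , to-x) =
      subst₂ (λ x y → x ∈ pick s e ∪ pick t g ⇔ y ∈ s ∷ t ∷ []) (sym x≡g) (sym to-x) (image-g s t)

ρ[]-copy : ∀ {k} (A : ThreeSubset k) → Copy A ρ[ A ]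
ρ[]-copy A = record
  { e = zero ; g = suc zero ; e∈E = ∈⊤ ; g∈E = ∈⊤ ; e≢g = λ ()
  ; cover = λ { {zero} _ → inj₁ refl ; {suc zero} _ → inj₂ refl }
  ; ranks = λ { outside outside → refl ; inside outside → refl
              ; outside inside → refl ; inside inside → refl }
  }

ρ[]-isKPolymatroid : ∀ {k} (A : ThreeSubset k) → IsKPolymatroid k ρ[ A ]
ρ[]-isKPolymatroid A zero       _ = +≤+ (ℕ.≤-trans (ℕ.<⇒≤ (ThreeSubset.b<c A)) (ThreeSubset.c≤k A))
ρ[]-isKPolymatroid A (suc zero) _ = +≤+ (ThreeSubset.c≤k A)

ThreeSubset-≡ : ∀ {k} {A B : ThreeSubset k} → let open ThreeSubset in
                a A ≡ a B → b A ≡ b B → c A ≡ c B → A ≡ B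
ThreeSubset-≡ {A = A} {B} refl refl refl
  rewrite ℕ.≤-irrelevant (ThreeSubset.a<b A) (ThreeSubset.a<b B)
        | ℕ.≤-irrelevant (ThreeSubset.b<c A) (ThreeSubset.b<c B)
        | ℕ.≤-irrelevant (ThreeSubset.c≤k A) (ThreeSubset.c≤k B) = refl

-- An isomorphism cannot exchange the two elements, since `b < c` on both sides. It therefore
-- matches them in order, and the ranks determine `b`, `c` and then `a`.
ρ[]-injective : ∀ {k} (A B : ThreeSubset k) → ρ[ A ] ≅ ρ[ B ] → A ≡ B
ρ[]-injective A B iso = from-copy (≅⇒copy iso)
  where
  open ThreeSubset

  from-copy : Copy B ρ[ A ] → A ≡ B
  from-copy record { e = zero ; g = zero ; e≢g = e≢g } = contradiction refl e≢g
  from-copy record { e = suc zero ; g = suc zero ; e≢g = e≢g } = contradiction refl e≢g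
  from-copy record { e = zero ; g = suc zero ; ranks = ranks } =
    ThreeSubset-≡ (ℕ.+-cancelʳ-≡ (c A) (a A) (a B)
                    (trans (ℤ.+-injective (ranks inside inside)) (cong (a B ℕ.+_) (sym c≡))))
                  (ℤ.+-injective (ranks inside outside)) c≡
    where
    c≡ : c A ≡ c B
    c≡ = ℤ.+-injective (ranks outside inside)
  from-copy record { e = suc zero ; g = zero ; ranks = ranks } =
    contradiction (b<c B)
      (ℕ.<-asym (subst₂ ℕ._<_ (ℤ.+-injective (ranks outside inside))
                              (ℤ.+-injective (ranks inside outside)) (b<c A)))

-- Counting three-element subsets

-- `Chain r n` encodes the `r`-element subsets of the numbers below `n`, largest element first. The
-- constructors of `<′` separate the case that the largest element is `n - 1` from the case that it
-- is smaller.
data Chain : ℕ → ℕ → Set where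
  []   : ∀ {n} → Chain 0 n
  link : ∀ {r n} m → m ℕ.<′ n → Chain r m → Chain (suc r) n

-- Pascal's rule: a chain below `suc n` either starts with `n` and continues with `r` elements below
-- `n`, or lies entirely below `n`.
Fin↔Chain : ∀ n r → Fin (n C r) ↔ Chain r n
Fin↔Chain n zero =
  mk↔ₛ′ (λ _ → []) (λ _ → zero) (λ { [] → refl }) (λ { zero → refl })
Fin↔Chain zero (suc r) =
  mk↔ₛ′ (λ ()) (λ { (link m (ℕ.≤′-reflexive ()) _) }) (λ { (link m (ℕ.≤′-reflexive ()) _) }) (λ ())
Fin↔Chain (suc n) (suc r) =
  subst (λ N → Fin N ↔ Chain (suc r) (suc n)) (nCk+nC[k+1]≡[n+1]C[k+1] n r)
    (↔-trans +↔⊎ (↔-trans (Fin↔Chain n r ⊎-↔ Fin↔Chain n (suc r)) (mk↔ₛ′ to from to∘from from∘to)))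
  where
  to : Chain r n ⊎ Chain (suc r) n → Chain (suc r) (suc n)
  to (inj₁ ms)              = link n ℕ.≤′-refl ms
  to (inj₂ (link m m<n ms)) = link m (ℕ.≤′-step m<n) ms

  from : Chain (suc r) (suc n) → Chain r n ⊎ Chain (suc r) n
  from (link _ ℕ.≤′-refl ms)       = inj₁ ms
  from (link m (ℕ.≤′-step m<n) ms) = inj₂ (link m m<n ms)

  to∘from : ∀ ms → to (from ms) ≡ ms
  to∘from (link _ ℕ.≤′-refl ms)       = refl
  to∘from (link m (ℕ.≤′-step m<n) ms) = refl

  from∘to : ∀ ms → from (to ms) ≡ ms
  from∘to (inj₁ ms)              = refl
  from∘to (inj₂ (link m m<n ms)) = refl

≤′-irrelevant : ∀ {m n} (p q : m ℕ.≤′ n) → p ≡ q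
≤′-irrelevant ℕ.≤′-refl       ℕ.≤′-refl       = refl
≤′-irrelevant ℕ.≤′-refl       (ℕ.≤′-step n<n) = contradiction (ℕ.≤′⇒≤ n<n) ℕ.1+n≰n
≤′-irrelevant (ℕ.≤′-step n<n) ℕ.≤′-refl       = contradiction (ℕ.≤′⇒≤ n<n) ℕ.1+n≰n
≤′-irrelevant (ℕ.≤′-step p)   (ℕ.≤′-step q)   = cong ℕ.≤′-step (≤′-irrelevant p q)

-- The bound is `suc k` because the set from 0 to `k` has `k + 1` elements: `c ≤ k` is read as
-- `c < suc k`.
Chain↔ThreeSubset : ∀ k → Chain 3 (suc k) ↔ ThreeSubset k
Chain↔ThreeSubset k =
  mk↔ₛ′ to from (λ A → ThreeSubset-≡ {A = to (from A)} {A} refl refl refl) from∘to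
  where
  to : Chain 3 (suc k) → ThreeSubset k
  to (link c c<1+k (link b b<c (link a a<b []))) = record
    { a = a ; b = b ; c = c
    ; a<b = ℕ.≤′⇒≤ a<b ; b<c = ℕ.≤′⇒≤ b<c ; c≤k = ℕ.s≤s⁻¹ (ℕ.≤′⇒≤ c<1+k)
    }

  from : ThreeSubset k → Chain 3 (suc k)
  from A = link c (ℕ.≤⇒≤′ (s≤s c≤k)) (link b (ℕ.≤⇒≤′ b<c) (link a (ℕ.≤⇒≤′ a<b) []))
    where open ThreeSubset A

  from∘to : ∀ ms → from (to ms) ≡ ms
  from∘to (link c c<1+k (link b b<c (link a a<b [])))
    rewrite ≤′-irrelevant (ℕ.≤⇒≤′ (s≤s (ℕ.s≤s⁻¹ (ℕ.≤′⇒≤ c<1+k)))) c<1+k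
          | ≤′-irrelevant (ℕ.≤⇒≤′ (ℕ.≤′⇒≤ b<c)) b<c
          | ≤′-irrelevant (ℕ.≤⇒≤′ (ℕ.≤′⇒≤ a<b)) a<b = refl

theorem5p2 : (k : ℕ) → 2 ≤ k →
    (∀ {n : ℕ} {E : Subset n} (ρ : Polymatroid E) → IsKPolymatroid k ρ →
    (IsExcludedMinor k ρ ⇔ (Σ[ A ∈ ThreeSubset k ] ρ ≅ ρ[ A ])))
    × ExactlyExcludedMinors k (suc k C 3)
theorem5p2 k _ =
  (λ ρ k-poly → mk⇔
    (λ excluded → let A , copy = excluded⇒copy ρ k-poly excluded in A , copy⇒≅ copy)
    (λ (A , iso) → copy⇒excluded {ρ = ρ} (≅⇒copy {A = A} iso) k-poly)) ,
  τ , τ-injective , τ-complete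
  where
  triples : Fin (suc k C 3) ↔ ThreeSubset k
  triples = ↔-trans (Fin↔Chain (suc k) 3) (Chain↔ThreeSubset k)

  open Inverse triples

  τ : Fin (suc k C 3) → ExcludedMinor k
  τ i = record
    { ρ               = ρ[ to i ]
    ; isKPolymatroid  = ρ[]-isKPolymatroid (to i)
    ; isExcludedMinor = copy⇒excluded (ρ[]-copy (to i)) (ρ[]-isKPolymatroid (to i))
    }

  open ExcludedMinor

  τ-injective : ∀ i j → ρ (τ i) ≅ ρ (τ j) → i ≡ j
  τ-injective i j iso =
    trans (sym (strictlyInverseʳ i))
      (trans (cong from (ρ[]-injective (to i) (to j) iso)) (strictlyInverseʳ j))

  τ-complete : ∀ (σ : ExcludedMinor k) → ∃[ i ] ρ σ ≅ ρ (τ i)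
  τ-complete σ with excluded⇒copy (ρ σ) (isKPolymatroid σ) (isExcludedMinor σ)
  ... | A , copy =
    from A , subst (λ B → ρ σ ≅ ρ[ B ]) (sym (strictlyInverseˡ A)) (copy⇒≅ copy)
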